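{- Let $J$ be an instance consisting only of $(1/2)$-tight jobs, i.e. $p_j>\frac12(d_j-r_j)$ for every $j\in J$, and let $\beta\in(0,1)$. Let $J_\beta$ be the instance obtained from $J$ by replacing each job $j$ by a job $j_\beta$ with the same time window $[r_j,d_j]$ and processing time $p_j+(1-\beta)(d_j-r_j-p_j)$ (so its laxity is $\beta(d_j-r_j-p_j)$). Then $m(J_\beta)\le \frac{4}{\beta}\, m(J)$.
   Context: Each job $j$ has release date $r_j$, processing time $p_j$ and deadline $d_j$ (here possibly rational, processing may be split at arbitrary times) with $p_j\le d_j-r_j$. For a job set $J$, $m(J)$ denotes the minimum number of identical machines admitting a feasible preemptive schedule, i.e. one processing each job for $p_j$ time units within $[r_j,d_j]$, with each machine processing at most one job at a time, no job on two machines simultaneously, and preemption and migration allowed.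
   Formalization: The parameter β, the release dates, processing times and deadlines, and the times at which a schedule may switch jobs are taken to be rational numbers rather than real numbers. -}

module Defs where

open import Data.Nat using (ℕ; suc)
open import Data.Integer using (+_)
open import Data.Rational using (ℚ; 0ℚ; 1ℚ; ½; _+_; _*_; _-_; _≤_; _<_; _/_)
open import Data.Fin using (Fin; inject₁; suc; _≟_)
open import Data.Maybe using (Maybe; just; nothing)
open import Data.Product using (Σ; _×_)
open import Relation.Binary.PropositionalEquality using (_≡_)
open import Relation.Nullary using (yes; no)

-- A job: release date r, processing time p, deadline d (rationals).
record Job : Set where
  constructor job
  field
    r : ℚ
    p : ℚ
    d : ℚ
open Job public

Instance : ℕ → Set
Instance n = Fin n → Job

WellFormed : ∀ {n} → Instance n → Set
WellFormed J = ∀ j → p (J j) ≤ d (J j) - r (J j)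

HalfTight : ∀ {n} → Instance n → Set
HalfTight J = ∀ j → ½ * (d (J j) - r (J j)) < p (J j)

ℕtoℚ : ℕ → ℚ
ℕtoℚ k = (+ k) / 1

sumFin : ∀ k → (Fin k → ℚ) → ℚ
sumFin 0 f = 0ℚ
sumFin (suc k) f = f Data.Fin.zero + sumFin k (λ i → f (suc i))

runs : ∀ {n} → Maybe (Fin n) → Fin n → ℚ
runs nothing j = 0ℚ
runs (just j′) j with j′ ≟ j
... | yes _ = 1ℚ
... | no _ = 0ℚ

-- A preemptive schedule of n jobs on m machines: breakpoints
-- t 0 ≤ t 1 ≤ … ≤ t K; during [t k, t (k+1)) machine i runs σ k i
-- (nothing = idle).  Preemption and migration are allowed since the
-- assignment may change arbitrarily between consecutive intervals.
record Schedule (n m : ℕ) : Set where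
  field
    K : ℕ
    t : Fin (suc K) → ℚ
    σ : Fin K → Fin m → Maybe (Fin n)
open Schedule public

start end : ∀ {n m} (S : Schedule n m) → Fin (K S) → ℚ
start S k = t S (inject₁ k)
end S k = t S (suc k)

IsFeasibleSchedule : ∀ {n m} → Instance n → Schedule n m → Set
IsFeasibleSchedule {n} {m} J S =
  (∀ k → start S k ≤ end S k)
  × (∀ k i i′ j → σ S k i ≡ just j → σ S k i′ ≡ just j → i ≡ i′)
  × (∀ k i j → σ S k i ≡ just j → (r (J j) ≤ start S k × end S k ≤ d (J j)))
  × (∀ j → sumFin (K S) (λ k → sumFin m (λ i → runs (σ S k i) j * (end S k - start S k))) ≡ p (J j))

Feasible : ∀ {n} → Instance n → ℕ → Set
Feasible {n} J m = Σ (Schedule n m) (IsFeasibleSchedule J)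

IsMinMachines : ∀ {n} → Instance n → ℕ → Set
IsMinMachines J k = Feasible J k × (∀ k′ → Feasible J k′ → k Data.Nat.≤ k′)

stretch : ∀ {n} → ℚ → Instance n → Instance n
stretch β J j = job (r (J j)) (p (J j) + (1ℚ - β) * (d (J j) - r (J j) - p (J j))) (d (J j))

{-# OPTIONS --safe #-}
-- After scaling to unit slots, feasibility is an integral transportation problem, so
-- by augmentation it suffices to bound, for every set I of slots, the work the
-- stretched jobs are forced to do in I. Let β = a / b. Spread the mass of I to both
-- sides by queues serving at rate a / b, which gives weights of total mass at most
-- (2 / β) |I|. Every window is then either filled or contains 1 / β times its share of
-- I, so tightness makes the forced work of a job of J with respect to the weights at
-- least 1 / (2 − β) times that of the stretched job in I. Hence the latter work is at
-- most (4 / β − 2) m |I|, and the slack 2m absorbs rounding 4m / β down.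
module Submission where

open import Defs
open import Data.Bool using (Bool; true; false; not)
import Data.Bool.Properties as Bool
open import Data.Fin as Fin using (Fin; zero; suc; toℕ; inject₁)
import Data.Fin.Properties as Fin
open import Data.Maybe as Maybe using (Maybe; just; nothing)
open import Data.Maybe.Properties using (just-injective)
import Data.Nat as ℕ
open import Data.Nat using (ℕ; zero; suc; z≤n; s≤s)
import Data.Nat.Properties as ℕ
open import Data.Product using (∃; _×_; _,_; proj₁; proj₂)
open import Function using (_∘_)
open import Relation.Nullary using (yes; no; contradiction; _×-dec_)
open import Relation.Binary.PropositionalEquality
open import Algebra.Properties.Semiring.Sum ℕ.+-*-semiring

-- The obstacle is that I by itself says too little about J. If E slots of I lie in the window of a
-- job of laxity l, the job is forced to do E - l there, its stretched version E - βl; the first may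
-- be negative while the second is large. Enlarging I by the factor 1 / β repairs this: weight E / β
-- in the window forces E / β - l = (E - βl) / β on the original job, so the laxities match exactly.
-- The enlargement may not fit into the window, but then it fills it and the original job
-- contributes all of p, while its stretched version needs at most p + (1 - β) l ≤ (2 - β) p; this
-- is where tightness enters. One choice of weights has to suit all windows at once, and a window
-- may extend from I to the left or to the right, so mass is sent both ways. That is the 2 in 2 / β,
-- and 2 (2 - β) / β = 4 / β - 2.

module Slots where

  open import Data.Nat using (_+_; _*_; _∸_; _⊔_; _⊓_; _≤_; _<_; NonZero; >-nonZero; >-nonZero⁻¹)
  open import Data.Nat.DivMod using (_/_; _%_; m≡m%n+[m/n]*n; m%n<n; m/n*n≤m)
  open import Data.Nat.Induction using (<-wellFounded)
  open import Data.Nat.Properties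
  open import Data.Nat.Tactic.RingSolver using (solve-∀)
  open import Data.Sum using (_⊎_; inj₁; inj₂)
  open import Induction.WellFounded using (Acc; acc)

  -- Finite sums of natural numbers

  𝟙 : Bool → ℕ
  𝟙 true  = 1
  𝟙 false = 0

  count : ∀ {n} → (Fin n → Bool) → ℕ
  count v = sum (𝟙 ∘ v)

  sum-mono : ∀ {n} {f g : Fin n → ℕ} → (∀ i → f i ≤ g i) → sum f ≤ sum g
  sum-mono {zero}  f≤g = z≤n
  sum-mono {suc n} f≤g = +-mono-≤ (f≤g zero) (sum-mono (f≤g ∘ suc))

  sum-mono-< : ∀ {n} {f g : Fin n → ℕ} i → (∀ k → f k ≤ g k) → f i < g i → sum f < sum g
  sum-mono-< zero    f≤g fi<gi = +-mono-<-≤ fi<gi (sum-mono (f≤g ∘ suc))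
  sum-mono-< (suc i) f≤g fi<gi = +-mono-≤-< (f≤g zero) (sum-mono-< i (f≤g ∘ suc) fi<gi)

  sum-zero : ∀ {n} {f : Fin n → ℕ} → (∀ i → f i ≡ 0) → sum f ≡ 0
  sum-zero {zero}  f≡0 = refl
  sum-zero {suc n} f≡0 = cong₂ _+_ (f≡0 zero) (sum-zero (f≡0 ∘ suc))

  term≤sum : ∀ {n} (f : Fin n → ℕ) i → f i ≤ sum f
  term≤sum f zero    = m≤m+n _ _
  term≤sum f (suc i) = ≤-trans (term≤sum (f ∘ suc) i) (m≤n+m _ _)

  -- Stated additively to avoid subtracting the changed term.
  sum-change : ∀ {n} (f g : Fin n → ℕ) i → (∀ k → k ≢ i → f k ≡ g k) → sum f + g i ≡ sum g + f i
  sum-change {suc n} f g zero eq = begin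
    f zero + sum (f ∘ suc) + g zero ≡⟨ cong (λ x → f zero + x + g zero) (sum-cong-≗ (λ k → eq (suc k) λ ())) ⟩
    f zero + sum (g ∘ suc) + g zero ≡⟨ cong (_+ g zero) (+-comm (f zero) _) ⟩
    sum (g ∘ suc) + f zero + g zero ≡⟨ +-comm _ (g zero) ⟩
    g zero + (sum (g ∘ suc) + f zero) ≡⟨ +-assoc (g zero) _ _ ⟨
    g zero + sum (g ∘ suc) + f zero ∎
    where open ≡-Reasoning
  sum-change {suc n} f g (suc i) eq = begin
    f zero + sum (f ∘ suc) + g (suc i)   ≡⟨ +-assoc (f zero) _ _ ⟩
    f zero + (sum (f ∘ suc) + g (suc i)) ≡⟨ cong₂ _+_ (eq zero λ ()) (sum-change (f ∘ suc) (g ∘ suc) i (λ k k≢i → eq (suc k) λ { refl → k≢i refl })) ⟩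
    g zero + (sum (g ∘ suc) + f (suc i)) ≡⟨ +-assoc (g zero) _ _ ⟨
    g zero + sum (g ∘ suc) + f (suc i)   ∎
    where open ≡-Reasoning

  select : ∀ {n} k l (u : Fin n → Bool) → count u ≡ k + l →
           ∃ λ v → (∀ i → v i ≡ true → u i ≡ true) × count v ≡ k
  select {n} zero l u eq = (λ _ → false) , (λ _ ()) , sum-zero {n} (λ _ → refl)
  select {suc n} (suc k) l u eq with u zero in u0
  ... | true  = let v , v⊆u , cv = select k l (u ∘ suc) (suc-injective eq) in
    (λ { zero → true ; (suc i) → v i }) , (λ { zero _ → u0 ; (suc i) → v⊆u i }) , cong suc cv
  ... | false = let v , v⊆u , cv = select (suc k) l (u ∘ suc) eq in
    (λ { zero → false ; (suc i) → v i }) , (λ { zero () ; (suc i) → v⊆u i }) , cv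

  -- Integral transportation: jobs are assigned to distinct slots of their windows

  module Assignment {n T : ℕ} (win : Fin n → Fin T → Bool) (N : ℕ) where

    Assign : Set
    Assign = Fin n → Fin T → Bool

    load : Assign → Fin T → ℕ
    load z s = count (λ j → z j s)

    set : Assign → Fin n → Fin T → Bool → Assign
    set z j s b j′ s′ with j Fin.≟ j′ | s Fin.≟ s′
    ... | yes _ | yes _ = b
    ... | _     | _     = z j′ s′

    set-eq : ∀ z j s b → set z j s b j s ≡ b
    set-eq z j s b with j Fin.≟ j | s Fin.≟ s
    ... | yes _  | yes _  = refl
    ... | no j≢j | _      = contradiction refl j≢j
    ... | yes _  | no s≢s = contradiction refl s≢s

    set-job : ∀ z j s b {j′} s′ → j′ ≢ j → set z j s b j′ s′ ≡ z j′ s′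
    set-job z j s b {j′} s′ j′≢j with j Fin.≟ j′ | s Fin.≟ s′
    ... | yes e | yes _ = contradiction (sym e) j′≢j
    ... | yes _ | no _  = refl
    ... | no _  | yes _ = refl
    ... | no _  | no _  = refl

    set-slot : ∀ z j s b j′ {s′} → s′ ≢ s → set z j s b j′ s′ ≡ z j′ s′
    set-slot z j s b j′ {s′} s′≢s with j Fin.≟ j′ | s Fin.≟ s′
    ... | yes _ | yes e = contradiction (sym e) s′≢s
    ... | yes _ | no _  = refl
    ... | no _  | yes _ = refl
    ... | no _  | no _  = refl

    load-set : ∀ z j s b → load (set z j s b) s + 𝟙 (z j s) ≡ load z s + 𝟙 b
    load-set z j s b = trans
      (sum-change _ _ j (λ k k≢j → cong 𝟙 (set-job z j s b s k≢j)))
      (cong (λ x → load z s + 𝟙 x) (set-eq z j s b))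

    load-set-slot : ∀ z j s b {s′} → s′ ≢ s → load (set z j s b) s′ ≡ load z s′
    load-set-slot z j s b s′≢s = sum-cong-≗ (λ k → cong 𝟙 (set-slot z j s b k s′≢s))

    total-set : ∀ z j s b → count (set z j s b j) + 𝟙 (z j s) ≡ count (z j) + 𝟙 b
    total-set z j s b = trans
      (sum-change _ _ s (λ k k≢s → cong 𝟙 (set-slot z j s b j k≢s)))
      (cong (λ x → count (z j) + 𝟙 x) (set-eq z j s b))

    total-set-job : ∀ z j s b {j′} → j′ ≢ j → count (set z j s b j′) ≡ count (z j′)
    total-set-job z j s b j′≢j = sum-cong-≗ (λ k → cong 𝟙 (set-job z j s b k j′≢j))

    Within : Assign → Set
    Within z = ∀ j t → z j t ≡ true → win j t ≡ true

    -- One unit of load can be taken away from slot s, rearranging z inside G only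
    -- and never filling a slot beyond N unless it was that full before.
    record Room (z : Assign) (G : Fin T → Bool) (s : Fin T) : Set where
      constructor mkRoom
      field
        z′      : Assign
        outside : ∀ j t → G t ≡ false → z′ j t ≡ z j t
        shrinks : ∀ j → z′ j s ≡ true → z j s ≡ true
        within  : Within z′
        total   : ∀ j → count (z′ j) ≡ count (z j)
        room    : suc (load z′ s) ≤ load z s ⊔ N
        bounded : ∀ t → load z′ t ≤ load z t ⊔ N

    insert : (Fin T → Bool) → Fin T → Fin T → Bool
    insert G s t with s Fin.≟ t
    ... | yes _ = true
    ... | no _  = G t

    insert-other : ∀ G s t → insert G s t ≡ false → s ≢ t × G t ≡ false
    insert-other G s t e with s Fin.≟ t
    ... | no s≢t = s≢t , e

    insert-cases : ∀ G s t → insert G s t ≡ true → s ≡ t ⊎ G t ≡ true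
    insert-cases G s t e with s Fin.≟ t
    ... | yes s≡t = inj₁ s≡t
    ... | no _    = inj₂ e

    insert-new : ∀ G s → insert G s s ≡ true
    insert-new G s with s Fin.≟ s
    ... | yes _  = refl
    ... | no s≢s = contradiction refl s≢s

    widen : ∀ {z G s} u → Room z G s → Room z (insert G u) s
    widen {G = G} u (mkRoom z′ o sh w t r b) =
      mkRoom z′ (λ j t e → o j t (proj₂ (insert-other G u t e))) sh w t r b

    true≢false : ∀ {b} → b ≡ true → b ≢ false
    true≢false refl ()

    -- One step of an augmenting path: the rearrangement inside `G` frees a unit in `t`, then `j`
    -- moves from `s` to `t`. Since `s` lies outside `G`, the rearrangement leaves `s` untouched and
    -- `j` still runs there.
    shift : ∀ {z G} s t j → G s ≡ false → G t ≡ true → z j s ≡ true → win j t ≡ true → z j t ≡ false →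
            Room z G t → Room z (insert G s) s
    shift {z} {G} s t j Gs Gt zjs wjt zjt (mkRoom z₁ out shr wi tot ro bou) = mkRoom z₃
      (λ j′ u e → let s≢u , Gu = insert-other G s u e in
         trans (set-slot z₂ j t true j′ λ { refl → true≢false Gt Gu })
        (trans (set-slot z₁ j s false j′ (s≢u ∘ sym)) (out j′ u Gu)))
      shrinks within total room bounded
      where
      s≢t : s ≢ t
      s≢t refl = true≢false Gt Gs
      z₂ z₃ : Assign
      z₂ = set z₁ j s false
      z₃ = set z₂ j t true
      z₁js : z₁ j s ≡ true
      z₁js = trans (out j s Gs) zjs
      -- This is the purpose of `shrinks`: freeing `t` brings no new job into `t`, so `j` can still
      -- be placed there.
      z₁jt : z₁ j t ≡ false
      z₁jt with z₁ j t in e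
      ... | true  = contradiction zjt (true≢false (shr j e))
      ... | false = refl
      z₂jt : z₂ j t ≡ false
      z₂jt = trans (set-slot z₁ j s false j (s≢t ∘ sym)) z₁jt
      shrinks : ∀ j′ → z₃ j′ s ≡ true → z j′ s ≡ true
      shrinks j′ e with j′ Fin.≟ j
      ... | yes refl = zjs
      ... | no j′≢j  = trans (sym (out j′ s Gs)) (trans (sym (set-job z₁ j s false s j′≢j))
                         (trans (sym (set-job z₂ j t true s j′≢j)) e))
      within : Within z₃
      within j′ u e with j′ Fin.≟ j | u Fin.≟ t
      ... | yes refl | yes refl = wjt
      ... | no j′≢j  | _ = wi j′ u (trans (sym (trans (set-job z₂ j t true u j′≢j) (set-job z₁ j s false u j′≢j))) e)
      ... | yes refl | no u≢t with u Fin.≟ s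
      ...   | yes refl = wi j s z₁js
      ...   | no u≢s   = wi j u (trans (sym (trans (set-slot z₂ j t true j u≢t) (set-slot z₁ j s false j u≢s))) e)
      total : ∀ j′ → count (z₃ j′) ≡ count (z j′)
      total j′ with j′ Fin.≟ j
      ... | no j′≢j = trans (total-set-job z₂ j t true j′≢j) (trans (total-set-job z₁ j s false j′≢j) (tot j′))
      ... | yes refl = begin
        count (z₃ j)                  ≡⟨ +-identityʳ _ ⟨
        count (z₃ j) + 0              ≡⟨ cong (λ b → count (z₃ j) + 𝟙 b) z₂jt ⟨
        count (z₃ j) + 𝟙 (z₂ j t)     ≡⟨ total-set z₂ j t true ⟩
        count (z₂ j) + 1              ≡⟨ cong (λ b → count (z₂ j) + 𝟙 b) z₁js ⟨
        count (z₂ j) + 𝟙 (z₁ j s)     ≡⟨ total-set z₁ j s false ⟩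
        count (z₁ j) + 0              ≡⟨ +-identityʳ _ ⟩
        count (z₁ j)                  ≡⟨ tot j ⟩
        count (z j)                   ∎
        where open ≡-Reasoning
      load-s : suc (load z₃ s) ≡ load z s
      load-s = begin
        suc (load z₃ s)               ≡⟨ cong suc (load-set-slot z₂ j t true s≢t) ⟩
        suc (load z₂ s)               ≡⟨ +-comm 1 _ ⟩
        load z₂ s + 1                 ≡⟨ cong (λ b → load z₂ s + 𝟙 b) z₁js ⟨
        load z₂ s + 𝟙 (z₁ j s)        ≡⟨ load-set z₁ j s false ⟩
        load z₁ s + 0                 ≡⟨ +-identityʳ _ ⟩
        load z₁ s                     ≡⟨ sum-cong-≗ (λ k → cong 𝟙 (out k s Gs)) ⟩
        load z s                      ∎
        where open ≡-Reasoning
      load-t : load z₃ t ≡ suc (load z₁ t)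
      load-t = begin
        load z₃ t                     ≡⟨ +-identityʳ _ ⟨
        load z₃ t + 0                 ≡⟨ cong (λ b → load z₃ t + 𝟙 b) z₂jt ⟨
        load z₃ t + 𝟙 (z₂ j t)        ≡⟨ load-set z₂ j t true ⟩
        load z₂ t + 1                 ≡⟨ +-comm _ 1 ⟩
        suc (load z₂ t)               ≡⟨ cong suc (load-set-slot z₁ j s false (s≢t ∘ sym)) ⟩
        suc (load z₁ t)               ∎
        where open ≡-Reasoning
      room : suc (load z₃ s) ≤ load z s ⊔ N
      room = ≤-trans (≤-reflexive load-s) (m≤m⊔n _ _)
      bounded : ∀ u → load z₃ u ≤ load z u ⊔ N
      bounded u with u Fin.≟ s | u Fin.≟ t
      ... | yes refl | _        = ≤-trans (n≤1+n _) room
      ... | no _     | yes refl = ≤-trans (≤-reflexive load-t) ro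
      ... | no u≢s   | no u≢t   = ≤-trans (≤-reflexive (trans (load-set-slot z₂ j t true u≢t) (load-set-slot z₁ j s false u≢s))) (bou u)

    count-insert : ∀ G s → G s ≡ false → count (not ∘ insert G s) < count (not ∘ G)
    count-insert G s Gs = sum-mono-< s le lt
      where
      le : ∀ t → 𝟙 (not (insert G s t)) ≤ 𝟙 (not (G t))
      le t with s Fin.≟ t
      ... | yes _ = z≤n
      ... | no _  = ≤-refl
      lt : 𝟙 (not (insert G s s)) < 𝟙 (not (G s))
      lt rewrite insert-new G s | Gs = s≤s z≤n

    -- No edge of the residual graph enters `G`.
    Closed : Assign → (Fin T → Bool) → Set
    Closed z G = ∀ j s t → G s ≡ false → G t ≡ true → z j s ≡ true → win j t ≡ true → z j t ≡ true

    -- Backward search in the residual graph: the source of an edge into `G` joins `G` by `shift`,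
    -- so the complement of `G` shrinks until no such edge is left.
    grow : ∀ z G → Acc _<_ (count (not ∘ G)) →
           (∀ t → G t ≡ true → Room z G t) → (∀ t → G t ≡ false → N ≤ load z t) →
           ∃ λ G′ → (∀ t → G′ t ≡ true → Room z G′ t) × (∀ t → G′ t ≡ false → N ≤ load z t) × Closed z G′
    grow z G (acc rs) rooms full with Fin.any? (λ j → Fin.any? λ s → Fin.any? λ t →
      (G s Bool.≟ false) ×-dec (G t Bool.≟ true) ×-dec (z j s Bool.≟ true) ×-dec (win j t Bool.≟ true) ×-dec (z j t Bool.≟ false))
    ... | yes (j , s , t , Gs , Gt , zjs , wjt , zjt) =
      grow z (insert G s) (rs (count-insert G s Gs)) rooms′ (λ u e → full u (proj₂ (insert-other G s u e)))
      where
      rooms′ : ∀ u → insert G s u ≡ true → Room z (insert G s) u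
      rooms′ u e with insert-cases G s u e
      ... | inj₁ refl = shift s t j Gs Gt zjs wjt zjt (rooms t Gt)
      ... | inj₂ Gu   = widen s (rooms u Gu)
    ... | no ¬edge = G , rooms , full , closed
      where
      closed : Closed z G
      closed j s t Gs Gt zjs wjt with z j t in zjt
      ... | true  = refl
      ... | false = contradiction (j , s , t , Gs , Gt , zjs , wjt , zjt) ¬edge

    underloaded : Assign → Fin T → Bool
    underloaded z t with load z t <? N
    ... | yes _ = true
    ... | no _  = false

    grow-underloaded : ∀ z → Within z →
      ∃ λ G → (∀ t → G t ≡ true → Room z G t) × (∀ t → G t ≡ false → N ≤ load z t) × Closed z G
    grow-underloaded z w = grow z (underloaded z) (<-wellFounded _) rooms full
      where
      rooms : ∀ t → underloaded z t ≡ true → Room z (underloaded z) t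
      rooms t e with load z t <? N
      ... | yes lt = mkRoom z (λ _ _ _ → refl) (λ _ e → e) w (λ _ → refl) (≤-trans lt (m≤n⊔m _ _)) (λ _ → m≤m⊔n _ _)
      full : ∀ t → underloaded z t ≡ false → N ≤ load z t
      full t e with load z t <? N
      ... | no ≮ = ≮⇒≥ ≮

    -- Hall's condition in deficiency form

    module _ (q h : Fin n → ℕ) (window : ∀ j → count (win j) ≡ q j + h j)
             (hall : ∀ (I : Fin T → Bool) →
                     sum (λ j → sum (λ s → 𝟙 (I s) * 𝟙 (win j s)) ∸ h j) ≤ N * count I) where

      module _ (z : Assign) (w : Within z) (tot : ∀ j → count (z j) ≡ q j)
               (G : Fin T → Bool) (full : ∀ t → G t ≡ false → N ≤ load z t) (closed : Closed z G) where

        I : Fin T → Bool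
        I = not ∘ G

        𝟙-mono : ∀ {x y} → (x ≡ true → y ≡ true) → 𝟙 x ≤ 𝟙 y
        𝟙-mono {false} _ = z≤n
        𝟙-mono {true}  f rewrite f refl = ≤-refl

        𝟙-split : ∀ b x → 𝟙 (not b) * x + 𝟙 b * x ≡ x
        𝟙-split true  x = +-identityʳ x
        𝟙-split false x = trans (+-identityʳ _) (+-identityʳ x)

        sum-split : ∀ (f : Fin T → ℕ) → sum (λ s → 𝟙 (I s) * f s) + sum (λ s → 𝟙 (G s) * f s) ≡ sum f
        sum-split f = trans (sym (∑-distrib-+ (λ s → 𝟙 (I s) * f s) _)) (sum-cong-≗ (λ s → 𝟙-split (G s) (f s)))

        -- A job running in I fills its whole window outside I, so only h j slots of it are left idle in I.
        job-in-I : ∀ j → sum (λ s → 𝟙 (I s) * 𝟙 (z j s)) ≤ sum (λ s → 𝟙 (I s) * 𝟙 (win j s)) ∸ h j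
        job-in-I j with Fin.any? (λ s → (G s Bool.≟ false) ×-dec (z j s Bool.≟ true))
        ... | no ∄ = ≤-trans (≤-reflexive (sum-zero zero-term)) z≤n
          where
          zero-term : ∀ s → 𝟙 (I s) * 𝟙 (z j s) ≡ 0
          zero-term s with G s in Gs | z j s in zjs
          ... | true  | _     = refl
          ... | false | false = refl
          ... | false | true  = contradiction (s , Gs , zjs) ∄
        ... | yes (s , Gs , zjs) = ≤-reflexive (begin
          zI                  ≡⟨ m+n∸n≡m zI (h j) ⟨
          zI + h j ∸ h j      ≡⟨ cong (_∸ h j) (+-cancelʳ-≡ zG _ _ eq) ⟩
          wI ∸ h j            ∎)
          where
          open ≡-Reasoning
          zI = sum (λ s → 𝟙 (I s) * 𝟙 (z j s))
          zG = sum (λ s → 𝟙 (G s) * 𝟙 (z j s))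
          wI = sum (λ s → 𝟙 (I s) * 𝟙 (win j s))
          wG = sum (λ s → 𝟙 (G s) * 𝟙 (win j s))
          same : ∀ t → 𝟙 (G t) * 𝟙 (z j t) ≡ 𝟙 (G t) * 𝟙 (win j t)
          same t with G t in Gt
          ... | false = refl
          ... | true  = cong (1 *_) (≤-antisym (𝟙-mono (w j t)) (𝟙-mono (closed j s t Gs Gt zjs)))
          eq : zI + h j + zG ≡ wI + zG
          eq = begin
            zI + h j + zG    ≡⟨ +-assoc zI _ _ ⟩
            zI + (h j + zG)  ≡⟨ cong (zI +_) (+-comm (h j) zG) ⟩
            zI + (zG + h j)  ≡⟨ +-assoc zI _ _ ⟨
            zI + zG + h j    ≡⟨ cong (_+ h j) (trans (sum-split (𝟙 ∘ z j)) (tot j)) ⟩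
            q j + h j        ≡⟨ window j ⟨
            count (win j)    ≡⟨ sum-split (𝟙 ∘ win j) ⟨
            wI + wG          ≡⟨ cong (wI +_) (sum-cong-≗ same) ⟨
            wI + zG          ∎

        load-in-I : sum (λ s → 𝟙 (I s) * load z s) ≤ N * count I
        load-in-I = begin
          sum (λ s → 𝟙 (I s) * load z s)                ≡⟨ sum-cong-≗ (λ s → *-distribˡ-sum (𝟙 (I s)) (λ j → 𝟙 (z j s))) ⟩
          sum (λ s → sum (λ j → 𝟙 (I s) * 𝟙 (z j s)))   ≡⟨ ∑-comm (λ s j → 𝟙 (I s) * 𝟙 (z j s)) ⟩
          sum (λ j → sum (λ s → 𝟙 (I s) * 𝟙 (z j s)))   ≤⟨ sum-mono job-in-I ⟩
          _                                             ≤⟨ hall I ⟩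
          N * count I                                   ∎
          where open ≤-Reasoning

        -- Otherwise the complement of `G` would consist of slots of load at least `N`, one of them
        -- above `N`, against the bound that Hall's condition puts on their total load.
        overloaded∈G : ∀ s → N < load z s → G s ≡ true
        overloaded∈G s N<load with G s in Gs
        ... | true  = refl
        ... | false = contradiction load-in-I (<⇒≱ (begin-strict
          N * count I                      ≡⟨ *-distribˡ-sum N (𝟙 ∘ I) ⟩
          sum (λ t → N * 𝟙 (I t))          <⟨ sum-mono-< s le lt ⟩
          sum (λ t → 𝟙 (I t) * load z t)   ∎))
          where
          open ≤-Reasoning
          le : ∀ t → N * 𝟙 (I t) ≤ 𝟙 (I t) * load z t
          le t with G t in Gt
          ... | true  = ≤-reflexive (*-zeroʳ N)
          ... | false = ≤-trans (≤-reflexive (*-identityʳ N)) (≤-trans (full t Gt) (≤-reflexive (sym (+-identityʳ _))))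
          lt : N * 𝟙 (I s) < 𝟙 (I s) * load z s
          lt rewrite Gs | *-identityʳ N | +-identityʳ (load z s) = N<load

      Balanced : Set
      Balanced = ∃ λ z → Within z × (∀ j → count (z j) ≡ q j) × (∀ s → load z s ≤ N)

      overload : Assign → ℕ
      overload z = sum (λ s → load z s ∸ N)

      -- All jobs keep their full amount throughout; only the excess over `N` changes. By `bounded`
      -- no slot gains excess, and by `room` the overloaded slot `s` loses some.
      rebalance : ∀ z → Acc _<_ (overload z) → Within z → (∀ j → count (z j) ≡ q j) → Balanced
      rebalance z (acc rs) w tot with Fin.any? (λ s → N <? load z s)
      ... | no ∄ = z , w , tot , λ s → ≮⇒≥ (λ lt → ∄ (s , lt))
      ... | yes (s , N<load) with grow-underloaded z w
      ...   | G , rooms , full , closed with rooms s (overloaded∈G z w tot G full closed s N<load)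
      ...   | mkRoom z′ _ _ w′ tot′ room bounded =
        rebalance z′ (rs (sum-mono-< s le lt)) w′ (λ j → trans (tot′ j) (tot j))
        where
        le : ∀ t → load z′ t ∸ N ≤ load z t ∸ N
        le t = ≤-trans (∸-monoˡ-≤ N (bounded t)) (≤-reflexive (trans (∸-distribʳ-⊔ N (load z t) N)
                 (trans (cong (load z t ∸ N ⊔_) (n∸n≡0 N)) (⊔-identityʳ _))))
        lt : load z′ s ∸ N < load z s ∸ N
        lt with N ≤? load z′ s
        ... | yes N≤ = ∸-monoˡ-< (subst (suc (load z′ s) ≤_) (m≥n⇒m⊔n≡m (<⇒≤ N<load)) room) N≤
        ... | no N≰  = subst (_< load z s ∸ N) (sym (m≤n⇒m∸n≡0 (<⇒≤ (≰⇒> N≰)))) (m<n⇒0<n∸m N<load)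

      assignment : Balanced
      assignment = rebalance z₀ (<-wellFounded _)
        (λ j → proj₁ (proj₂ (select (q j) (h j) (win j) (window j))))
        (λ j → proj₂ (proj₂ (select (q j) (h j) (win j) (window j))))
        where
        -- Any `q j` slots of the window serve as a start; overloads are repaired afterwards.
        z₀ : Assign
        z₀ j = proj₁ (select (q j) (h j) (win j) (window j))

  -- Spreading a set of slots

  rangeSum : (ℕ → ℕ) → ℕ → ℕ → ℕ
  rangeSum f u zero    = 0
  rangeSum f u (suc k) = f u + rangeSum f (suc u) k

  rangeSum-cong : ∀ {f g} u k → (∀ i → u ≤ i → i < u + k → f i ≡ g i) → rangeSum f u k ≡ rangeSum g u k
  rangeSum-cong u zero    eq = refl
  rangeSum-cong u (suc k) eq = cong₂ _+_ (eq u ≤-refl (m<m+n u (s≤s z≤n)))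
    (rangeSum-cong (suc u) k (λ i u<i i< → eq i (<⇒≤ u<i) (subst (i <_) (sym (+-suc u k)) i<)))

  rangeSum-mono : ∀ {f g} u k → (∀ i → f i ≤ g i) → rangeSum f u k ≤ rangeSum g u k
  rangeSum-mono u zero    le = z≤n
  rangeSum-mono u (suc k) le = +-mono-≤ (le u) (rangeSum-mono (suc u) k le)

  rangeSum-zero : ∀ u k → rangeSum (λ _ → 0) u k ≡ 0
  rangeSum-zero u zero    = refl
  rangeSum-zero u (suc k) = rangeSum-zero (suc u) k

  rangeSum-++ : ∀ f u k l → rangeSum f u (k + l) ≡ rangeSum f u k + rangeSum f (u + k) l
  rangeSum-++ f u zero    l = cong (λ v → rangeSum f v l) (sym (+-identityʳ u))
  rangeSum-++ f u (suc k) l = begin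
    f u + rangeSum f (suc u) (k + l)                              ≡⟨ cong (f u +_) (rangeSum-++ f (suc u) k l) ⟩
    f u + (rangeSum f (suc u) k + rangeSum f (suc u + k) l)       ≡⟨ +-assoc (f u) _ _ ⟨
    f u + rangeSum f (suc u) k + rangeSum f (suc u + k) l         ≡⟨ cong (λ v → f u + rangeSum f (suc u) k + rangeSum f v l) (+-suc u k) ⟨
    f u + rangeSum f (suc u) k + rangeSum f (u + suc k) l         ∎
    where open ≡-Reasoning

  rangeSum-shift : ∀ f u k → rangeSum (f ∘ suc) u k ≡ rangeSum f (suc u) k
  rangeSum-shift f u zero    = refl
  rangeSum-shift f u (suc k) = cong (f (suc u) +_) (rangeSum-shift f (suc u) k)

  sum-toℕ : ∀ T (f : ℕ → ℕ) → sum {T} (f ∘ toℕ) ≡ rangeSum f 0 T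
  sum-toℕ zero    f = refl
  sum-toℕ (suc T) f = cong (f 0 +_) (trans (sum-toℕ T (f ∘ suc)) (rangeSum-shift f 0 T))

  between : ℕ → ℕ → ℕ → Bool
  between u v s with u ≤? s | s <? v
  ... | yes _ | yes _ = true
  ... | _     | _     = false

  between-true : ∀ {u v s} → u ≤ s → s < v → between u v s ≡ true
  between-true {u} {v} {s} u≤s s<v with u ≤? s | s <? v
  ... | yes _ | yes _ = refl
  ... | no ≰  | _     = contradiction u≤s ≰
  ... | yes _ | no ≮  = contradiction s<v ≮

  between-before : ∀ {u v s} → s < u → between u v s ≡ false
  between-before {u} {v} {s} s<u with u ≤? s | s <? v
  ... | yes u≤s | _ = contradiction u≤s (<⇒≱ s<u)
  ... | no _ | _    = refl

  between-after : ∀ {u v s} → v ≤ s → between u v s ≡ false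
  between-after {u} {v} {s} v≤s with u ≤? s | s <? v
  ... | yes _ | yes s<v = contradiction s<v (≤⇒≯ v≤s)
  ... | yes _ | no _    = refl
  ... | no _  | _       = refl

  between-sound : ∀ {u v s} → between u v s ≡ true → u ≤ s × s < v
  between-sound {u} {v} {s} e with u ≤? s | s <? v
  ... | yes u≤s | yes s<v = u≤s , s<v

  sum-between : ∀ T u k (f : ℕ → ℕ) → u + k ≤ T →
                sum {T} (λ s → 𝟙 (between u (u + k) (toℕ s)) * f (toℕ s)) ≡ rangeSum f u k
  sum-between T u k f u+k≤T = begin
    sum {T} (g ∘ toℕ)                                        ≡⟨ sum-toℕ T g ⟩
    rangeSum g 0 T                                           ≡⟨ cong (rangeSum g 0) (m+[n∸m]≡n u+k≤T) ⟨
    rangeSum g 0 (u + k + l)                                 ≡⟨ rangeSum-++ g 0 (u + k) l ⟩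
    rangeSum g 0 (u + k) + rangeSum g (u + k) l              ≡⟨ cong (_+ rangeSum g (u + k) l) (rangeSum-++ g 0 u k) ⟩
    rangeSum g 0 u + rangeSum g u k + rangeSum g (u + k) l   ≡⟨ cong₂ _+_ (cong₂ _+_ below inside) above ⟩
    0 + rangeSum f u k + 0                                   ≡⟨ +-identityʳ _ ⟩
    rangeSum f u k                                           ∎
    where
    open ≡-Reasoning
    l = T ∸ (u + k)
    g : ℕ → ℕ
    g s = 𝟙 (between u (u + k) s) * f s
    below : rangeSum g 0 u ≡ 0
    below = trans (rangeSum-cong 0 u (λ i _ i<u → cong (λ b → 𝟙 b * f i) (between-before i<u))) (rangeSum-zero 0 u)
    inside : rangeSum g u k ≡ rangeSum f u k
    inside = rangeSum-cong u k (λ i u≤i i< → trans (cong (λ b → 𝟙 b * f i) (between-true u≤i i<)) (*-identityˡ (f i)))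
    above : rangeSum g (u + k) l ≡ 0
    above = trans (rangeSum-cong (u + k) l (λ i ≤i _ → cong (λ b → 𝟙 b * f i) (between-after {u} ≤i))) (rangeSum-zero (u + k) l)

  -- The default 0 says that no work arrives beyond the horizon.
  extend : ∀ {T} → (Fin T → ℕ) → ℕ → ℕ
  extend {zero}  f _       = 0
  extend {suc T} f zero    = f zero
  extend {suc T} f (suc s) = extend (f ∘ suc) s

  extend-toℕ : ∀ {T} (f : Fin T → ℕ) s → extend f (toℕ s) ≡ f s
  extend-toℕ f zero    = refl
  extend-toℕ f (suc s) = extend-toℕ (f ∘ suc) s

  extend-all : ∀ {ℓ} (P : ℕ → Set ℓ) {T} (f : Fin T → ℕ) → P 0 → (∀ s → P (f s)) → ∀ s → P (extend f s)
  extend-all P {zero}  f p0 pf s       = p0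
  extend-all P {suc T} f p0 pf zero    = pf zero
  extend-all P {suc T} f p0 pf (suc s) = extend-all P (f ∘ suc) p0 (pf ∘ suc) s

  -- In slot s, x s units of work arrive; a queue serves a units per slot, working
  -- to the right (wr) and, in a mirrored copy, to the left (wl).
  module Queue (a : ℕ) (x : ℕ → ℕ) (x-large : ∀ s → x s ≡ 0 ⊎ a ≤ x s) (T : ℕ) where

    Q : ℕ → ℕ
    Q zero    = 0
    Q (suc s) = Q s + x s ∸ a

    wr : ℕ → ℕ
    wr s = a ⊓ (Q s + x s)

    -- The queue working to the left starts at the end of the horizon, so the recursion is on the
    -- distance to `T`. Then `P (suc s)` is the backlog with which slot `s` is reached from the
    -- right.
    remaining : ℕ → ℕ → ℕ
    remaining zero    s = 0
    remaining (suc k) s = remaining k (suc s) + x s ∸ a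

    P : ℕ → ℕ
    P s = remaining (T ∸ s) s

    P-step : ∀ s → s < T → P s ≡ P (suc s) + x s ∸ a
    P-step s s<T = cong (λ k → remaining k s) (+-∸-assoc 1 s<T)

    wl : ℕ → ℕ
    wl s = a ⊓ (P (suc s) + x s)

    -- Both queues may serve the same slot. The cap keeps the weight at most `a` and takes effect
    -- only at slots that are saturated anyway.
    w : ℕ → ℕ
    w s = a ⊓ (wr s + wl s)

    -- Conservation of work: each slot splits its content `y` into `a ⊓ y` served and `y ∸ a` passed
    -- on, and the sum telescopes.
    balance-r : ∀ u k → rangeSum wr u k + Q (u + k) ≡ Q u + rangeSum x u k
    balance-r u zero = trans (cong Q (+-identityʳ u)) (sym (+-identityʳ _))
    balance-r u (suc k) = begin
      wr u + rangeSum wr (suc u) k + Q (u + suc k)     ≡⟨ cong (λ v → wr u + rangeSum wr (suc u) k + Q v) (+-suc u k) ⟩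
      wr u + rangeSum wr (suc u) k + Q (suc u + k)     ≡⟨ +-assoc (wr u) _ _ ⟩
      wr u + (rangeSum wr (suc u) k + Q (suc u + k))   ≡⟨ cong (wr u +_) (balance-r (suc u) k) ⟩
      wr u + (Q (suc u) + rangeSum x (suc u) k)        ≡⟨ +-assoc (wr u) _ _ ⟨
      wr u + Q (suc u) + rangeSum x (suc u) k          ≡⟨ cong (_+ rangeSum x (suc u) k) (m⊓n+n∸m≡n a (Q u + x u)) ⟩
      Q u + x u + rangeSum x (suc u) k                 ≡⟨ +-assoc (Q u) _ _ ⟩
      Q u + (x u + rangeSum x (suc u) k)               ∎
      where open ≡-Reasoning

    balance-l : ∀ u k → u + k ≤ T → rangeSum wl u k + P u ≡ P (u + k) + rangeSum x u k
    balance-l u zero _ = trans (cong P (sym (+-identityʳ u))) (sym (+-identityʳ _))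
    balance-l u (suc k) le = begin
      wl u + rangeSum wl (suc u) k + P u               ≡⟨ regroup (wl u) _ (P u) ⟩
      rangeSum wl (suc u) k + (wl u + P u)             ≡⟨ cong (rangeSum wl (suc u) k +_) step ⟩
      rangeSum wl (suc u) k + (P (suc u) + x u)        ≡⟨ +-assoc (rangeSum wl (suc u) k) _ _ ⟨
      rangeSum wl (suc u) k + P (suc u) + x u          ≡⟨ cong (_+ x u) (balance-l (suc u) k le′) ⟩
      P (suc u + k) + rangeSum x (suc u) k + x u       ≡⟨ +-assoc (P (suc u + k)) _ _ ⟩
      P (suc u + k) + (rangeSum x (suc u) k + x u)     ≡⟨ cong₂ _+_ (cong P (sym (+-suc u k))) (+-comm _ (x u)) ⟩
      P (u + suc k) + (x u + rangeSum x (suc u) k)     ∎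
      where
      open ≡-Reasoning
      le′ : suc u + k ≤ T
      le′ = subst (_≤ T) (+-suc u k) le
      step : wl u + P u ≡ P (suc u) + x u
      step = trans (cong (wl u +_) (P-step u (≤-trans (s≤s (m≤m+n u k)) le′))) (m⊓n+n∸m≡n a (P (suc u) + x u))
      regroup : ∀ p q r → p + q + r ≡ q + (p + r)
      regroup = solve-∀

    wr≤w : ∀ s → wr s ≤ w s
    wr≤w s = ⊓-glb (m⊓n≤m a _) (m≤m+n _ _)

    wl≤w : ∀ s → wl s ≤ w s
    wl≤w s = ⊓-glb (m⊓n≤m a _) (m≤n+m _ _)

    w-sum : rangeSum w 0 T ≤ rangeSum x 0 T + rangeSum x 0 T
    w-sum = begin
      rangeSum w 0 T                       ≤⟨ rangeSum-mono 0 T (λ s → m⊓n≤n a _) ⟩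
      rangeSum (λ s → wr s + wl s) 0 T     ≡⟨ split 0 T ⟩
      rangeSum wr 0 T + rangeSum wl 0 T    ≤⟨ +-mono-≤ (≤-trans (m≤m+n _ (Q T)) (≤-reflexive (balance-r 0 T)))
                                                      (≤-trans (m≤m+n _ (P 0)) (≤-reflexive (trans (balance-l 0 T ≤-refl) (cong (_+ rangeSum x 0 T) P-end)))) ⟩
      rangeSum x 0 T + rangeSum x 0 T      ∎
      where
      open ≤-Reasoning
      regroup : ∀ p q r s → p + q + (r + s) ≡ p + r + (q + s)
      regroup = solve-∀
      split : ∀ u k → rangeSum (λ s → wr s + wl s) u k ≡ rangeSum wr u k + rangeSum wl u k
      split u zero    = refl
      split u (suc k) = trans (cong (wr u + wl u +_) (split (suc u) k)) (regroup (wr u) (wl u) _ _)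
      P-end : P T ≡ 0
      P-end = cong (λ k → remaining k T) (n∸n≡0 T)

    ⊓-small : ∀ {m n} → m ⊓ n < m → m ⊓ n ≡ n
    ⊓-small {m} {n} lt with ≤-total m n
    ... | inj₁ m≤n = contradiction (m≤n⇒m⊓n≡m m≤n) (<⇒≢ lt)
    ... | inj₂ n≤m = m≥n⇒m⊓n≡n n≤m

    saturated? : ∀ u k → rangeSum w u k ≡ a * k ⊎ ∃ λ k₁ → ∃ λ k₂ → k ≡ k₁ + suc k₂ × w (u + k₁) < a
    saturated? u zero = inj₁ (sym (*-zeroʳ a))
    saturated? u (suc k) with m≤n⇒m<n∨m≡n (m⊓n≤m a (wr u + wl u))
    ... | inj₁ lt = inj₂ (0 , k , refl , subst (λ v → w v < a) (sym (+-identityʳ u)) lt)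
    ... | inj₂ wu with saturated? (suc u) k
    ...   | inj₁ eq = inj₁ (trans (cong₂ _+_ wu eq) (sym (*-suc a k)))
    ...   | inj₂ (k₁ , k₂ , refl , lt) = inj₂ (suc k₁ , k₂ , refl , subst (λ v → w v < a) (sym (+-suc u k₁)) lt)

    -- At an unsaturated slot both queues run empty, so what arrives on either side
    -- of it within the range is served within the range.
    served : ∀ u k → u + k ≤ T → rangeSum w u k ≡ a * k ⊎ rangeSum x u k ≤ rangeSum w u k
    served u k le with saturated? u k
    ... | inj₁ eq = inj₁ eq
    ... | inj₂ (k₁ , k₂ , refl , lt) = inj₂ (begin
      rangeSum x u (k₁ + suc k₂)                                          ≡⟨ rangeSum-++ x u k₁ (suc k₂) ⟩
      rangeSum x u k₁ + (x v + rangeSum x (suc v) k₂)                     ≡⟨ cong (λ y → rangeSum x u k₁ + (y + rangeSum x (suc v) k₂)) xv ⟩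
      rangeSum x u k₁ + rangeSum x (suc v) k₂                             ≤⟨ +-mono-≤ (≤-trans (m≤n+m _ (Q u)) (≤-reflexive (sym (balance-r u k₁))))
                                                                                      (≤-trans (m≤n+m _ (P (suc v + k₂))) (≤-reflexive (sym (balance-l (suc v) k₂ le′)))) ⟩
      rangeSum wr u k₁ + Q v + (rangeSum wl (suc v) k₂ + P (suc v))       ≡⟨ regroup (rangeSum wr u k₁) (Q v) _ _ ⟩
      rangeSum wr u k₁ + (Q v + P (suc v) + rangeSum wl (suc v) k₂)       ≡⟨ cong (λ y → rangeSum wr u k₁ + (y + rangeSum wl (suc v) k₂)) wv ⟨
      rangeSum wr u k₁ + (w v + rangeSum wl (suc v) k₂)                   ≤⟨ +-mono-≤ (rangeSum-mono u k₁ wr≤w) (+-monoʳ-≤ (w v) (rangeSum-mono (suc v) k₂ wl≤w)) ⟩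
      rangeSum w u k₁ + (w v + rangeSum w (suc v) k₂)                     ≡⟨ rangeSum-++ w u k₁ (suc k₂) ⟨
      rangeSum w u (k₁ + suc k₂)                                          ∎)
      where
      open ≤-Reasoning
      v = u + k₁
      regroup : ∀ p q r s → p + q + (r + s) ≡ p + (q + s + r)
      regroup = solve-∀
      assoc : ∀ p q r → p + (q + suc r) ≡ suc (p + q) + r
      assoc = solve-∀
      le′ : suc v + k₂ ≤ T
      le′ = subst (_≤ T) (assoc u k₁ k₂) le
      sum<a : wr v + wl v < a
      sum<a = subst (_< a) (⊓-small lt) lt
      wr-v : wr v ≡ Q v + x v
      wr-v = ⊓-small (≤-trans (s≤s (m≤m+n _ _)) sum<a)
      wl-v : wl v ≡ P (suc v) + x v
      wl-v = ⊓-small (≤-trans (s≤s (m≤n+m _ _)) sum<a)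
      -- A nonzero arrival is at least `a` and would saturate the slot on its own.
      xv : x v ≡ 0
      xv with x-large v
      ... | inj₁ e   = e
      ... | inj₂ a≤x = contradiction sum<a (≤⇒≯ (≤-trans a≤x (≤-trans (m≤n+m _ (Q v)) (≤-trans (≤-reflexive (sym wr-v)) (m≤m+n _ _)))))
      wv : w v ≡ Q v + P (suc v)
      wv = trans (⊓-small lt) (cong₂ _+_ (trans wr-v (trans (cong (Q v +_) xv) (+-identityʳ _)))
                                         (trans wl-v (trans (cong (P (suc v) +_) xv) (+-identityʳ _))))

  -- The discrete counterpart of the rising sun lemma for the two one-sided maximal functions.
  spread : ∀ {T} a b → a ≤ b → (I : Fin T → Bool) →
    ∃ λ (w : Fin T → ℕ) → (∀ s → w s ≤ a) × sum w ≤ 2 * (b * count I) ×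
      (∀ u k → u + k ≤ T →
         sum {T} (λ s → 𝟙 (between u (u + k) (toℕ s)) * w s) ≡ a * k
       ⊎ b * sum {T} (λ s → 𝟙 (I s) * 𝟙 (between u (u + k) (toℕ s))) ≤ sum {T} (λ s → 𝟙 (between u (u + k) (toℕ s)) * w s))
  spread {T} a b a≤b I = Qu.w ∘ toℕ , (λ s → m⊓n≤m a _) , total , window
    where
    open ≤-Reasoning
    -- Weights are in units of 1 / a: each slot of `I` sends mass b / a = 1 / β in each direction,
    -- and a slot holds at most 1.
    x : ℕ → ℕ
    x = extend (λ s → b * 𝟙 (I s))
    x-large : ∀ s → x s ≡ 0 ⊎ a ≤ x s
    x-large = extend-all (λ y → y ≡ 0 ⊎ a ≤ y) {T} _ (inj₁ refl) large
      where
      large : ∀ s → b * 𝟙 (I s) ≡ 0 ⊎ a ≤ b * 𝟙 (I s)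
      large s with I s
      ... | true  = inj₂ (≤-trans a≤b (≤-reflexive (sym (*-identityʳ b))))
      ... | false = inj₁ (*-zeroʳ b)
    module Qu = Queue a x x-large T
    x-toℕ : ∀ (s : Fin T) → x (toℕ s) ≡ b * 𝟙 (I s)
    x-toℕ = extend-toℕ (λ s → b * 𝟙 (I s))
    sum-x : rangeSum x 0 T ≡ b * count I
    sum-x = trans (sym (sum-toℕ T x)) (trans (sum-cong-≗ x-toℕ) (sym (*-distribˡ-sum b (𝟙 ∘ I))))
    total : sum {T} (Qu.w ∘ toℕ) ≤ 2 * (b * count I)
    total = begin
      sum {T} (Qu.w ∘ toℕ)              ≡⟨ sum-toℕ T Qu.w ⟩
      rangeSum Qu.w 0 T                 ≤⟨ Qu.w-sum ⟩
      rangeSum x 0 T + rangeSum x 0 T   ≡⟨ cong₂ _+_ sum-x (trans sum-x (sym (+-identityʳ _))) ⟩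
      2 * (b * count I)                 ∎
    regroup : ∀ p q r → p * (q * r) ≡ r * (p * q)
    regroup = solve-∀
    window : ∀ u k → u + k ≤ T → _
    window u k le with Qu.served u k le
    ... | inj₁ eq = inj₁ (trans (sum-between T u k Qu.w le) eq)
    ... | inj₂ x≤w = inj₂ (begin
      b * sum {T} (λ s → 𝟙 (I s) * 𝟙 (between u (u + k) (toℕ s)))        ≡⟨ *-distribˡ-sum b (λ s → 𝟙 (I s) * 𝟙 (between u (u + k) (toℕ s))) ⟩
      sum {T} (λ s → b * (𝟙 (I s) * 𝟙 (between u (u + k) (toℕ s))))      ≡⟨ sum-cong-≗ (λ s → trans (regroup b (𝟙 (I s)) _) (cong (𝟙 (between u (u + k) (toℕ s)) *_) (sym (x-toℕ s)))) ⟩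
      sum {T} (λ s → 𝟙 (between u (u + k) (toℕ s)) * x (toℕ s))          ≡⟨ sum-between T u k x le ⟩
      rangeSum x u k                                                 ≤⟨ x≤w ⟩
      rangeSum Qu.w u k                                              ≡⟨ sum-between T u k Qu.w le ⟨
      sum {T} (λ s → 𝟙 (between u (u + k) (toℕ s)) * Qu.w (toℕ s))       ∎)

  count-between : ∀ T u k → u + k ≤ T → count {T} (λ s → between u (u + k) (toℕ s)) ≡ k
  count-between T u k le = trans (sum-cong-≗ {T} (λ s → sym (*-identityʳ _)))
                          (trans (sum-between T u k (λ _ → 1) le) (ones u k))
    where
    ones : ∀ u k → rangeSum (λ _ → 1) u k ≡ k
    ones u zero    = refl
    ones u (suc k) = cong suc (ones (suc u) k)

  -- In terms of b = a + c: (4b/a − 2) m ≤ N ≤ 4bm/a.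
  machines : ∀ a c m .{{_ : NonZero a}} → ∃ λ N → a * N ≤ 4 * ((a + c) * m) × 2 * ((a + 2 * c) * m) ≤ a * N
  -- Without machines the slack `2 * (a * m)` of the other case vanishes, but so does the quantity
  -- to be rounded.
  machines a c zero = 0 , subst (_≤ 4 * ((a + c) * 0)) (sym (*-zeroʳ a)) z≤n
    , ≤-reflexive (trans (cong (2 *_) (*-zeroʳ (a + 2 * c))) (sym (*-zeroʳ a)))
  machines a c m@(suc m-1) = N , subst (_≤ B) (*-comm N a) (m/n*n≤m B a) , +-cancelˡ-≤ (2 * (a * m)) _ _ (begin
    2 * (a * m) + 2 * ((a + 2 * c) * m)  ≡⟨ regroup a c m ⟩
    B                                    ≡⟨ m≡m%n+[m/n]*n B a ⟩
    B % a + N * a                        ≤⟨ +-mono-≤ (<⇒≤ (m%n<n B a)) (≤-reflexive (*-comm N a)) ⟩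
    a + a * N                            ≤⟨ +-monoˡ-≤ (a * N) (≤-trans (m≤m*n a m) (m≤n*m (a * m) 2)) ⟩
    2 * (a * m) + a * N                  ∎)
    where
    open ≤-Reasoning
    B = 4 * ((a + c) * m)
    N = B / a
    regroup : ∀ a c m → 2 * (a * m) + 2 * ((a + 2 * c) * m) ≡ 4 * ((a + c) * m)
    regroup = solve-∀

  -- Hall's condition for the stretched jobs

  module Discrete
    {n T : ℕ} (a c m N : ℕ) .{{_ : NonZero a}} (N-large : 2 * ((a + 2 * c) * m) ≤ a * N)
    -- Counted in slots: `u` is the release date, `k` the window length, `p` and `l` are processing
    -- time and laxity, `q` and `h` the same after stretching.
    (u k p l q h : Fin n → ℕ) (u+k≤T : ∀ j → u j + k j ≤ T)
    (k≡p+l : ∀ j → k j ≡ p j + l j) (k≡q+h : ∀ j → k j ≡ q j + h j)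
    (scaled : ∀ j → (a + c) * h j ≡ a * l j) (tight : ∀ j → l j ≤ p j)
    where

    win : Fin n → Fin T → Bool
    win j s = between (u j) (u j + k j) (toℕ s)

    module _ (y : Fin n → Fin T → ℕ) (y≤win : ∀ j s → y j s ≤ 𝟙 (win j s))
      (y-total : ∀ j → sum (y j) ≡ p j) (y-load : ∀ s → sum (λ j → y j s) ≤ m) where

      open ≤-Reasoning

      b : ℕ
      b = a + c

      module _ (I : Fin T → Bool) (w : Fin T → ℕ) (w≤a : ∀ s → w s ≤ a) where

        E W windowed : Fin n → ℕ
        E j = sum (λ s → 𝟙 (I s) * 𝟙 (win j s))
        W j = sum (λ s → y j s * w s)
        windowed j = sum (λ s → 𝟙 (win j s) * w s)

        -- This is (v - x)(a - w) ≥ 0, arranged so that nothing is subtracted.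
        exchange : ∀ {x v w a} → x ≤ v → w ≤ a → v * w + a * x ≤ x * w + a * v
        exchange {x} {v} {w} {a} x≤v w≤a with m≤n⇒∃[o]m+o≡n x≤v
        ... | d , refl = begin
          (x + d) * w + a * x       ≡⟨ regroup x d w a ⟩
          x * w + a * x + d * w     ≤⟨ +-monoʳ-≤ (x * w + a * x) (*-monoʳ-≤ d w≤a) ⟩
          x * w + a * x + d * a     ≡⟨ regroup′ x d w a ⟩
          x * w + a * (x + d)       ∎
          where
          regroup : ∀ x d w a → (x + d) * w + a * x ≡ x * w + a * x + d * w
          regroup = solve-∀
          regroup′ : ∀ x d w a → x * w + a * x + d * a ≡ x * w + a * (x + d)
          regroup′ = solve-∀

        -- Job j idles at most l j slots of its window, each of weight at most a.
        windowed≤ : ∀ j → windowed j ≤ W j + a * l j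
        windowed≤ j = +-cancelʳ-≤ (a * p j) _ _ (begin
          windowed j + a * p j                                       ≡⟨ cong (λ x → windowed j + a * x) (y-total j) ⟨
          windowed j + a * sum (y j)                                 ≡⟨ cong (windowed j +_) (*-distribˡ-sum a (y j)) ⟩
          windowed j + sum (λ s → a * y j s)                         ≡⟨ ∑-distrib-+ (λ s → 𝟙 (win j s) * w s) _ ⟨
          sum (λ s → 𝟙 (win j s) * w s + a * y j s)                  ≤⟨ sum-mono (λ s → exchange (y≤win j s) (w≤a s)) ⟩
          sum (λ s → y j s * w s + a * 𝟙 (win j s))                  ≡⟨ ∑-distrib-+ (λ s → y j s * w s) _ ⟩
          W j + sum (λ s → a * 𝟙 (win j s))                          ≡⟨ cong (W j +_) (*-distribˡ-sum a (λ s → 𝟙 (win j s))) ⟨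
          W j + a * count (win j)                                    ≡⟨ cong (λ x → W j + a * x) (trans (count-between T (u j) (k j) (u+k≤T j)) (k≡p+l j)) ⟩
          W j + a * (p j + l j)                                      ≡⟨ regroup (W j) a (p j) (l j) ⟩
          W j + a * l j + a * p j                                    ∎)
          where
          regroup : ∀ W a p l → W + a * (p + l) ≡ W + a * l + a * p
          regroup = solve-∀

        E≤k : ∀ j → E j ≤ k j
        E≤k j = subst (E j ≤_) (count-between T (u j) (k j) (u+k≤T j)) (sum-mono (λ s → le (I s)))
          where
          le : ∀ x {v} → 𝟙 x * v ≤ v
          le true  = ≤-reflexive (+-identityʳ _)
          le false = z≤n

        -- The factor `a + 2 * c`, which is 2b - a, is dictated by filled windows; the other case
        -- would give `a`.
        contribution : ∀ j → windowed j ≡ a * k j ⊎ b * E j ≤ windowed j →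
                       a * (b * (E j ∸ h j)) ≤ (a + 2 * c) * W j
        -- Here all of `p j` counts with weight `a`. The stretched job has
        -- `b * q j = b * p j + c * l j`, at most `(b + c) * p j` by tightness.
        contribution j (inj₁ filled) = begin
          a * (b * (E j ∸ h j))       ≤⟨ *-monoʳ-≤ a (begin
              b * (E j ∸ h j)         ≡⟨ *-distribˡ-∸ b (E j) (h j) ⟩
              b * E j ∸ b * h j       ≤⟨ ∸-monoˡ-≤ (b * h j) (*-monoʳ-≤ b (E≤k j)) ⟩
              b * k j ∸ b * h j       ≡⟨ cong₂ (λ x x′ → b * x ∸ x′) (k≡p+l j) (scaled j) ⟩
              b * (p j + l j) ∸ a * l j            ≡⟨ cong (_∸ a * l j) (regroup a c (p j) (l j)) ⟩
              b * p j + c * l j + a * l j ∸ a * l j ≡⟨ m+n∸n≡m _ (a * l j) ⟩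
              b * p j + c * l j                    ≤⟨ +-monoʳ-≤ (b * p j) (*-monoʳ-≤ c (tight j)) ⟩
              b * p j + c * p j                    ≡⟨ regroup′ a c (p j) ⟩
              (a + 2 * c) * p j                    ∎) ⟩
          a * ((a + 2 * c) * p j)     ≡⟨ regroup″ a (a + 2 * c) (p j) ⟩
          (a + 2 * c) * (a * p j)     ≤⟨ *-monoʳ-≤ (a + 2 * c) ap≤W ⟩
          (a + 2 * c) * W j           ∎
          where
          regroup : ∀ a c p l → (a + c) * (p + l) ≡ (a + c) * p + c * l + a * l
          regroup = solve-∀
          regroup′ : ∀ a c p → (a + c) * p + c * p ≡ (a + 2 * c) * p
          regroup′ = solve-∀
          regroup″ : ∀ x y z → x * (y * z) ≡ y * (x * z)
          regroup″ = solve-∀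
          ap≤W : a * p j ≤ W j
          ap≤W = +-cancelʳ-≤ (a * l j) _ _ (begin
            a * p j + a * l j   ≡⟨ *-distribˡ-+ a (p j) (l j) ⟨
            a * (p j + l j)     ≡⟨ cong (a *_) (k≡p+l j) ⟨
            a * k j             ≡⟨ filled ⟨
            windowed j          ≤⟨ windowed≤ j ⟩
            W j + a * l j       ∎)
        -- The weight `a * l j` that the original job can avoid is exactly `b * h j`, so the two
        -- laxities cancel.
        contribution j (inj₂ dense) = begin
          a * (b * (E j ∸ h j))       ≡⟨ cong (a *_) (*-distribˡ-∸ b (E j) (h j)) ⟩
          a * (b * E j ∸ b * h j)     ≤⟨ *-monoʳ-≤ a (∸-mono (≤-trans dense (windowed≤ j)) (≤-reflexive (sym (scaled j)))) ⟩
          a * (W j + a * l j ∸ a * l j)   ≡⟨ cong (a *_) (m+n∸n≡m (W j) (a * l j)) ⟩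
          a * W j                     ≤⟨ *-monoˡ-≤ (W j) (m≤m+n a (2 * c)) ⟩
          (a + 2 * c) * W j           ∎

        sum-W : sum W ≤ m * sum w
        sum-W = begin
          sum W                                        ≡⟨ ∑-comm (λ j s → y j s * w s) ⟩
          sum (λ s → sum (λ j → y j s * w s))          ≡⟨ sum-cong-≗ (λ s → *-distribʳ-sum (w s) (λ j → y j s)) ⟨
          sum (λ s → sum (λ j → y j s) * w s)          ≤⟨ sum-mono (λ s → *-monoˡ-≤ (w s) (y-load s)) ⟩
          sum (λ s → m * w s)                          ≡⟨ *-distribˡ-sum m w ⟨
          m * sum w                                    ∎

      -- The factor 2 from `spread` and `a + 2 * c` from `contribution` combine to the left side of
      -- `N-large`. The common factor `a * b` keeps the computation in ℕ and is cancelled at the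
      -- end.
      hall : ∀ I → sum (λ j → sum (λ s → 𝟙 (I s) * 𝟙 (win j s)) ∸ h j) ≤ N * count I
      hall I with spread a b (m≤m+n a c) I
      ... | w , w≤a , sum-w , served =
        *-cancelˡ-≤ b (*-cancelˡ-≤ a (begin
          a * (b * sum e)                       ≡⟨ trans (sym (*-assoc a b (sum e))) (*-distribˡ-sum (a * b) e) ⟩
          sum (λ j → a * b * e j)               ≡⟨ sum-cong-≗ (λ j → *-assoc a b (e j)) ⟩
          sum (λ j → a * (b * e j))             ≤⟨ sum-mono (λ j → contribution I w w≤a j (served (u j) (k j) (u+k≤T j))) ⟩
          sum (λ j → (a + 2 * c) * W I w w≤a j) ≡⟨ *-distribˡ-sum (a + 2 * c) (W I w w≤a) ⟨
          (a + 2 * c) * sum (W I w w≤a)         ≤⟨ *-monoʳ-≤ (a + 2 * c) (≤-trans (sum-W I w w≤a) (*-monoʳ-≤ m sum-w)) ⟩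
          (a + 2 * c) * (m * (2 * (b * count I)))   ≡⟨ regroup (a + 2 * c) m b (count I) ⟩
          2 * ((a + 2 * c) * m) * (b * count I)     ≤⟨ *-monoˡ-≤ (b * count I) N-large ⟩
          a * N * (b * count I)                     ≡⟨ regroup′ a N b (count I) ⟩
          a * (b * (N * count I))                   ∎))
        where
        instance
          _ : NonZero b
          _ = >-nonZero (≤-trans (>-nonZero⁻¹ a) (m≤m+n a c))
        e : Fin n → ℕ
        e j = sum (λ s → 𝟙 (I s) * 𝟙 (win j s)) ∸ h j
        regroup : ∀ x m b i → x * (m * (2 * (b * i))) ≡ 2 * (x * m) * (b * i)
        regroup = solve-∀
        regroup′ : ∀ a N b i → a * N * (b * i) ≡ a * (b * (N * i))
        regroup′ = solve-∀

      discrete : ∃ λ z → Assignment.Within win N z × (∀ j → count (z j) ≡ q j) × (∀ s → count (λ j → z j s) ≤ N)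
      discrete = Assignment.assignment win N q h
        (λ j → trans (count-between T (u j) (k j) (u+k≤T j)) (k≡q+h j)) hall

  -- Boolean form of `runs`, so that machine time can be counted in ℕ.
  serves : ∀ {n} → Maybe (Fin n) → Fin n → Bool
  serves nothing   j = false
  serves (just j′) j with j′ Fin.≟ j
  ... | yes _ = true
  ... | no _  = false

  serves-sound : ∀ {n} (x : Maybe (Fin n)) j → serves x j ≡ true → x ≡ just j
  serves-sound (just j′) j e with j′ Fin.≟ j
  ... | yes refl = refl

  count≤1 : ∀ {n} (v : Fin n → Bool) → (∀ i i′ → v i ≡ true → v i′ ≡ true → i ≡ i′) → count v ≤ 1
  count≤1 {zero}  v unique = z≤n
  count≤1 {suc n} v unique with v zero in v0
  ... | true  = ≤-reflexive (cong suc (sum-zero (λ i → rest i)))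
    where
    rest : ∀ i → 𝟙 (v (suc i)) ≡ 0
    rest i with v (suc i) in vi
    ... | false = refl
    ... | true  with () ← unique zero (suc i) v0 vi
  ... | false = count≤1 (v ∘ suc) (λ i i′ e e′ → Fin.suc-injective (unique (suc i) (suc i′) e e′))

  -- From schedules to slots

  module Slotted {n m K} (τ : Fin (suc K) → ℕ) (τ-mono : ∀ k → τ (inject₁ k) ≤ τ (suc k))
    (σ : Fin K → Fin m → Maybe (Fin n))
    (σ-unique : ∀ k i i′ j → σ k i ≡ just j → σ k i′ ≡ just j → i ≡ i′) where

    open ≤-Reasoning

    active : Fin K → ℕ → Bool
    active k s = between (τ (inject₁ k)) (τ (suc k)) s

    usage : Fin K → Fin n → ℕ
    usage k j = count (λ i → serves (σ k i) j)

    y : Fin n → ℕ → ℕ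
    y j s = sum (λ k → 𝟙 (active k s) * usage k j)

    -- The intervals are half-open and ordered: once one contains `s`, all later ones start after
    -- `s`. Intervals of length zero contain no slot.
    active≤1 : ∀ s → count (λ k → active k s) ≤ 1
    active≤1 = go K τ τ-mono
      where
      before : ∀ K (τ : Fin (suc K) → ℕ) → (∀ k → τ (inject₁ k) ≤ τ (suc k)) → ∀ s → s < τ zero →
               count (λ k → between (τ (inject₁ k)) (τ (suc k)) s) ≡ 0
      before zero    τ mono s s<τ = refl
      before (suc K) τ mono s s<τ = cong₂ _+_ (cong 𝟙 (between-before s<τ))
        (before K (τ ∘ suc) (mono ∘ suc) s (≤-trans s<τ (mono zero)))
      go : ∀ K (τ : Fin (suc K) → ℕ) → (∀ k → τ (inject₁ k) ≤ τ (suc k)) → ∀ s →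
           count (λ k → between (τ (inject₁ k)) (τ (suc k)) s) ≤ 1
      go zero    τ mono s = z≤n
      go (suc K) τ mono s with between (τ zero) (τ (suc zero)) s in e
      ... | false = go K (τ ∘ suc) (mono ∘ suc) s
      ... | true  = ≤-reflexive (cong suc (before K (τ ∘ suc) (mono ∘ suc) s (proj₂ (between-sound {τ zero} e))))

    sum-active : ∀ s x → sum (λ k → 𝟙 (active k s) * x) ≤ x
    sum-active s x = begin
      sum (λ k → 𝟙 (active k s) * x)     ≡⟨ *-distribʳ-sum x (λ k → 𝟙 (active k s)) ⟨
      count (λ k → active k s) * x       ≤⟨ *-monoˡ-≤ x (active≤1 s) ⟩
      1 * x                              ≡⟨ *-identityˡ x ⟩
      x                                  ∎

    y-load : ∀ s → sum (λ j → y j s) ≤ m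
    y-load s = begin
      sum (λ j → y j s)                                        ≡⟨ ∑-comm (λ j k → 𝟙 (active k s) * usage k j) ⟩
      sum (λ k → sum (λ j → 𝟙 (active k s) * usage k j))       ≡⟨ sum-cong-≗ (λ k → *-distribˡ-sum (𝟙 (active k s)) (usage k)) ⟨
      sum (λ k → 𝟙 (active k s) * sum (usage k))               ≤⟨ sum-mono (λ k → *-monoʳ-≤ (𝟙 (active k s)) (busy≤m k)) ⟩
      sum (λ k → 𝟙 (active k s) * m)                           ≤⟨ sum-active s m ⟩
      m                                                        ∎
      where
      ones : ∀ m → sum {m} (λ _ → 1) ≡ m
      ones zero    = refl
      ones (suc m) = cong suc (ones m)
      busy≤m : ∀ k → sum (usage k) ≤ m
      busy≤m k = begin
        sum (usage k)                                          ≡⟨ ∑-comm (λ j i → 𝟙 (serves (σ k i) j)) ⟩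
        sum (λ i → count (serves (σ k i)))                     ≤⟨ sum-mono (λ i → count≤1 (serves (σ k i)) (λ j j′ e e′ →
                                                                    just-injective (trans (sym (serves-sound (σ k i) j e)) (serves-sound (σ k i) j′ e′)))) ⟩
        sum {m} (λ _ → 1)                                      ≡⟨ ones m ⟩
        m                                                      ∎

    -- As `j` is never on two machines at once, its usage is at most 1, and an active interval that
    -- runs `j` lies inside the window.
    y-window : ∀ j {u v} → (∀ k i → σ k i ≡ just j → u ≤ τ (inject₁ k) × τ (suc k) ≤ v) →
               ∀ s → y j s ≤ 𝟙 (between u v s)
    y-window j {u} {v} inside s = ≤-trans (sum-mono term) (sum-active s (𝟙 (between u v s)))
      where
      term : ∀ k → 𝟙 (active k s) * usage k j ≤ 𝟙 (active k s) * 𝟙 (between u v s)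
      term k with active k s in e
      ... | false = z≤n
      ... | true with Fin.any? (λ i → serves (σ k i) j Bool.≟ true)
      ...   | no ∄ = ≤-trans (≤-reflexive (trans (+-identityʳ _) (sum-zero (λ i → cong 𝟙 (Bool.¬-not (λ e′ → ∄ (i , e′))))))) z≤n
      ...   | yes (i , e′) = +-monoˡ-≤ 0 (begin
        usage k j              ≤⟨ count≤1 _ (λ i i′ e e′ → σ-unique k i i′ j (serves-sound _ j e) (serves-sound _ j e′)) ⟩
        1                      ≡⟨ cong 𝟙 (between-true (≤-trans (proj₁ in-window) (proj₁ in-active)) (≤-trans (proj₂ in-active) (proj₂ in-window))) ⟨
        𝟙 (between u v s)      ∎)
        where
        in-window = inside k i (serves-sound _ j e′)
        in-active = between-sound {τ (inject₁ k)} e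

    y-total : ∀ T → (∀ k → τ k ≤ T) → ∀ j →
              sum {T} (y j ∘ toℕ) ≡ sum (λ k → usage k j * (τ (suc k) ∸ τ (inject₁ k)))
    y-total T τ≤T j = begin-equality
      sum {T} (y j ∘ toℕ)                                              ≡⟨ ∑-comm {T} (λ s k → 𝟙 (active k (toℕ s)) * usage k j) ⟩
      sum (λ k → sum {T} (λ s → 𝟙 (active k (toℕ s)) * usage k j))     ≡⟨ sum-cong-≗ term ⟩
      sum (λ k → usage k j * (τ (suc k) ∸ τ (inject₁ k)))              ∎
      where
      term : ∀ k → sum {T} (λ s → 𝟙 (active k (toℕ s)) * usage k j) ≡ usage k j * (τ (suc k) ∸ τ (inject₁ k))
      term k = begin-equality
        sum {T} (λ s → 𝟙 (active k (toℕ s)) * usage k j)     ≡⟨ *-distribʳ-sum {T} (usage k j) (λ s → 𝟙 (active k (toℕ s))) ⟨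
        count {T} (λ s → active k (toℕ s)) * usage k j       ≡⟨ cong (λ v → count {T} (λ s → between (τ (inject₁ k)) v (toℕ s)) * usage k j) end≡ ⟨
        count {T} (λ s → between (τ (inject₁ k)) (τ (inject₁ k) + δ) (toℕ s)) * usage k j
          ≡⟨ cong (_* usage k j) (count-between T (τ (inject₁ k)) δ (subst (_≤ T) (sym end≡) (τ≤T (suc k)))) ⟩
        δ * usage k j                                        ≡⟨ *-comm δ (usage k j) ⟩
        usage k j * δ                                        ∎
        where
        δ = τ (suc k) ∸ τ (inject₁ k)
        end≡ : τ (inject₁ k) + δ ≡ τ (suc k)
        end≡ = m+[n∸m]≡n (τ-mono k)

  -- From slots to schedules

  serves-suc : ∀ {n} (x : Maybe (Fin n)) j → serves (Maybe.map suc x) (suc j) ≡ serves x j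
  serves-suc nothing   j = refl
  serves-suc (just j′) j with j′ Fin.≟ j
  ... | yes refl = refl
  ... | no _     = refl

  serves-map-zero : ∀ {n} (x : Maybe (Fin n)) → serves (Maybe.map suc x) zero ≡ false
  serves-map-zero nothing  = refl
  serves-map-zero (just _) = refl

  -- Each selected job in turn takes the next free machine. The count in the conclusion says at once
  -- that selected jobs run, that none runs twice and that no other job runs.
  distribute : ∀ {n} N (v : Fin n → Bool) → count v ≤ N →
    ∃ λ (σ : Fin N → Maybe (Fin n)) → ∀ j → count (λ i → serves (σ i) j) ≡ 𝟙 (v j)
  distribute {zero} N v _ = (λ _ → nothing) , λ ()
  distribute {suc n} N v le with v zero in v0
  distribute {suc n} (suc N) v (s≤s le) | true with distribute N (v ∘ suc) le
  ... | σ , eq = (λ { zero → just zero ; (suc i) → Maybe.map suc (σ i) }) , λ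
    { zero    → trans (cong suc (sum-zero (λ i → cong 𝟙 (serves-map-zero (σ i))))) (cong 𝟙 (sym v0))
    ; (suc j) → trans (sum-cong-≗ (λ i → cong 𝟙 (serves-suc (σ i) j))) (eq j) }
  distribute {suc n} N v le | false with distribute N (v ∘ suc) le
  ... | σ , eq = Maybe.map suc ∘ σ , λ
    { zero    → trans (sum-zero (λ i → cong 𝟙 (serves-map-zero (σ i)))) (cong 𝟙 (sym v0))
    ; (suc j) → trans (sum-cong-≗ (λ i → cong 𝟙 (serves-suc (σ i) j))) (eq j) }

  serves-refl : ∀ {n} (j : Fin n) → serves (just j) j ≡ true
  serves-refl j with j Fin.≟ j
  ... | yes _  = refl
  ... | no j≢j = contradiction refl j≢j

  count≤1-unique : ∀ {n} (v : Fin n → Bool) → count v ≤ 1 → ∀ i i′ → v i ≡ true → v i′ ≡ true → i ≡ i′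
  count≤1-unique v le zero    zero     e e′ = refl
  count≤1-unique v le (suc i) (suc i′) e e′ = cong suc (count≤1-unique (v ∘ suc) (≤-trans (m≤n+m _ _) le) i i′ e e′)
  count≤1-unique v le zero    (suc i′) e e′ = contradiction le (<⇒≱ (+-mono-≤ (≤-reflexive (cong 𝟙 (sym e))) (≤-trans (≤-reflexive (cong 𝟙 (sym e′))) (term≤sum (𝟙 ∘ v ∘ suc) i′))))
  count≤1-unique v le (suc i) zero     e e′ = contradiction le (<⇒≱ (+-mono-≤ (≤-reflexive (cong 𝟙 (sym e′))) (≤-trans (≤-reflexive (cong 𝟙 (sym e))) (term≤sum (𝟙 ∘ v ∘ suc) i))))

  module Distributed {n N} (σ : Fin N → Maybe (Fin n)) (v : Fin n → Bool)
    (σ-count : ∀ j → count (λ i → serves (σ i) j) ≡ 𝟙 (v j)) where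

    𝟙≤1 : ∀ b → 𝟙 b ≤ 1
    𝟙≤1 true  = ≤-refl
    𝟙≤1 false = z≤n

    σ-unique : ∀ i i′ j → σ i ≡ just j → σ i′ ≡ just j → i ≡ i′
    σ-unique i i′ j e e′ = count≤1-unique (λ i → serves (σ i) j) (≤-trans (≤-reflexive (σ-count j)) (𝟙≤1 (v j))) i i′
      (trans (cong (λ x → serves x j) e) (serves-refl j)) (trans (cong (λ x → serves x j) e′) (serves-refl j))

    σ-sound : ∀ i j → σ i ≡ just j → v j ≡ true
    σ-sound i j e with v j in vj
    ... | true  = refl
    ... | false = contradiction (≤-trans (≤-reflexive (cong 𝟙 (sym (trans (cong (λ x → serves x j) e) (serves-refl j)))))
                    (≤-trans (term≤sum (λ i → 𝟙 (serves (σ i) j)) i) (≤-reflexive (trans (σ-count j) (cong 𝟙 vj))))) λ ()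

-- Rational time

open Slots
open import Data.Integer as ℤ using (+_)
import Data.Integer.Properties as ℤ
open import Data.List using (List; []; _∷_; _++_; map; tabulate)
open import Data.List.Relation.Unary.All as All using (All; []; _∷_)
import Data.List.Relation.Unary.All.Properties as All
open import Data.Rational
open import Data.Rational.Properties
open import Data.Rational.Solver using (module +-*-Solver)
import Data.Rational.Unnormalised as ℚᵘ
import Data.Rational.Unnormalised.Properties as ℚᵘ

-- `ℕtoℚ` normalises its fraction, so its arithmetic is checked on unnormalised representatives,
-- whose denominator is visibly 1.
toℚᵘ-ℕtoℚ : ∀ k → toℚᵘ (ℕtoℚ k) ℚᵘ.≃ ℚᵘ.mkℚᵘ (+ k) 0
toℚᵘ-ℕtoℚ k = toℚᵘ-fromℚᵘ (ℚᵘ.mkℚᵘ (+ k) 0)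

ℕtoℚ-+ : ∀ m n → ℕtoℚ (m ℕ.+ n) ≡ ℕtoℚ m + ℕtoℚ n
ℕtoℚ-+ m n = toℚᵘ-injective (begin
  toℚᵘ (ℕtoℚ (m ℕ.+ n))                        ≈⟨ toℚᵘ-ℕtoℚ (m ℕ.+ n) ⟩
  ℚᵘ.mkℚᵘ (+ (m ℕ.+ n)) 0                      ≈⟨ ℚᵘ.*≡* (cong (ℤ._* + 1) (cong₂ ℤ._+_ (sym (ℤ.*-identityʳ (+ m))) (sym (ℤ.*-identityʳ (+ n))))) ⟩
  ℚᵘ.mkℚᵘ (+ m) 0 ℚᵘ.+ ℚᵘ.mkℚᵘ (+ n) 0         ≈⟨ ℚᵘ.+-cong (toℚᵘ-ℕtoℚ m) (toℚᵘ-ℕtoℚ n) ⟨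
  toℚᵘ (ℕtoℚ m) ℚᵘ.+ toℚᵘ (ℕtoℚ n)             ≈⟨ toℚᵘ-homo-+ (ℕtoℚ m) (ℕtoℚ n) ⟨
  toℚᵘ (ℕtoℚ m + ℕtoℚ n)                       ∎)
  where open ℚᵘ.≃-Reasoning

ℕtoℚ-* : ∀ m n → ℕtoℚ (m ℕ.* n) ≡ ℕtoℚ m * ℕtoℚ n
ℕtoℚ-* m n = toℚᵘ-injective (begin
  toℚᵘ (ℕtoℚ (m ℕ.* n))                        ≈⟨ toℚᵘ-ℕtoℚ (m ℕ.* n) ⟩
  ℚᵘ.mkℚᵘ (+ (m ℕ.* n)) 0                      ≈⟨ ℚᵘ.*≡* (cong (ℤ._* + 1) (ℤ.pos-* m n)) ⟩
  ℚᵘ.mkℚᵘ (+ m) 0 ℚᵘ.* ℚᵘ.mkℚᵘ (+ n) 0         ≈⟨ ℚᵘ.*-cong (toℚᵘ-ℕtoℚ m) (toℚᵘ-ℕtoℚ n) ⟨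
  toℚᵘ (ℕtoℚ m) ℚᵘ.* toℚᵘ (ℕtoℚ n)             ≈⟨ toℚᵘ-homo-* (ℕtoℚ m) (ℕtoℚ n) ⟨
  toℚᵘ (ℕtoℚ m * ℕtoℚ n)                       ∎)
  where open ℚᵘ.≃-Reasoning

ℕtoℚ-nonNeg : ∀ k → 0ℚ ≤ ℕtoℚ k
ℕtoℚ-nonNeg k = toℚᵘ-cancel-≤ (ℚᵘ.≤-respʳ-≃ (ℚᵘ.≃-sym (toℚᵘ-ℕtoℚ k)) (ℚᵘ.nonNegative⁻¹ (ℚᵘ.mkℚᵘ (+ k) 0)))

ℕtoℚ-pos : ∀ k → 0ℚ < ℕtoℚ (suc k)
ℕtoℚ-pos k = toℚᵘ-cancel-< (ℚᵘ.<-respʳ-≃ (ℚᵘ.≃-sym (toℚᵘ-ℕtoℚ (suc k))) (ℚᵘ.positive⁻¹ (ℚᵘ.mkℚᵘ (+ suc k) 0)))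

ℕtoℚ-mono-≤ : ∀ {m n} → m ℕ.≤ n → ℕtoℚ m ≤ ℕtoℚ n
ℕtoℚ-mono-≤ {m} m≤n with ℕ.m≤n⇒∃[o]m+o≡n m≤n
... | d , refl = begin
  ℕtoℚ m             ≡⟨ +-identityʳ (ℕtoℚ m) ⟨
  ℕtoℚ m + 0ℚ        ≤⟨ +-monoʳ-≤ (ℕtoℚ m) (ℕtoℚ-nonNeg d) ⟩
  ℕtoℚ m + ℕtoℚ d    ≡⟨ ℕtoℚ-+ m d ⟨
  ℕtoℚ (m ℕ.+ d)     ∎
  where open ≤-Reasoning

ℕtoℚ-mono-< : ∀ {m n} → m ℕ.< n → ℕtoℚ m < ℕtoℚ n
ℕtoℚ-mono-< {m} {n} m<n = begin-strict
  ℕtoℚ m             ≡⟨ +-identityˡ (ℕtoℚ m) ⟨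
  0ℚ + ℕtoℚ m        <⟨ +-monoˡ-< (ℕtoℚ m) (ℕtoℚ-pos 0) ⟩
  ℕtoℚ 1 + ℕtoℚ m    ≡⟨ ℕtoℚ-+ 1 m ⟨
  ℕtoℚ (suc m)       ≤⟨ ℕtoℚ-mono-≤ m<n ⟩
  ℕtoℚ n             ∎
  where open ≤-Reasoning

natural-multiple : ∀ x → 0ℚ ≤ x → ∃ λ D → ∃ λ k → x * ℕtoℚ (suc D) ≡ ℕtoℚ k
natural-multiple x@(mkℚ (+ n) d-1 _) _ = d-1 , n , toℚᵘ-injective (begin
  toℚᵘ (x * ℕtoℚ (suc d-1))                          ≈⟨ toℚᵘ-homo-* x (ℕtoℚ (suc d-1)) ⟩
  toℚᵘ x ℚᵘ.* toℚᵘ (ℕtoℚ (suc d-1))                  ≈⟨ ℚᵘ.*-congˡ {toℚᵘ x} (toℚᵘ-ℕtoℚ (suc d-1)) ⟩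
  ℚᵘ.mkℚᵘ (+ n) d-1 ℚᵘ.* ℚᵘ.mkℚᵘ (+ suc d-1) 0       ≈⟨ ℚᵘ.*≡* (trans (ℤ.*-identityʳ _) (cong (λ d → + n ℤ.* + suc d) (sym (ℕ.*-identityʳ d-1)))) ⟩
  ℚᵘ.mkℚᵘ (+ n) 0                                    ≈⟨ toℚᵘ-ℕtoℚ n ⟨
  toℚᵘ (ℕtoℚ n)                                      ∎)
  where open ℚᵘ.≃-Reasoning
natural-multiple (mkℚ (ℤ.-[1+ n ]) d-1 _) (*≤* ())

-- Common units and time grids

common-denominator : ∀ xs → All (0ℚ ≤_) xs →
  ∃ λ D → All (λ x → ∃ λ k → x * ℕtoℚ (suc D) ≡ ℕtoℚ k) xs
common-denominator [] [] = 0 , []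
common-denominator (x ∷ xs) (0≤x ∷ 0≤xs) with natural-multiple x 0≤x | common-denominator xs 0≤xs
-- The successor of this number unfolds to the product `suc D * suc E` of the two denominators.
... | D , k , eq | E , eqs = E ℕ.+ D ℕ.* suc E ,
  ((k ℕ.* suc E , (begin
      x * ℕtoℚ (suc D ℕ.* suc E)                  ≡⟨ cong (x *_) (ℕtoℚ-* (suc D) (suc E)) ⟩
      x * (ℕtoℚ (suc D) * ℕtoℚ (suc E))           ≡⟨ *-assoc x _ _ ⟨
      x * ℕtoℚ (suc D) * ℕtoℚ (suc E)             ≡⟨ cong (_* ℕtoℚ (suc E)) eq ⟩
      ℕtoℚ k * ℕtoℚ (suc E)                       ≡⟨ ℕtoℚ-* k (suc E) ⟨
      ℕtoℚ (k ℕ.* suc E)                          ∎)) ∷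
   All.map (λ {v} (l , e) → suc D ℕ.* l , (begin
      v * ℕtoℚ (suc D ℕ.* suc E)                  ≡⟨ cong (λ d → v * ℕtoℚ d) (ℕ.*-comm (suc D) (suc E)) ⟩
      v * ℕtoℚ (suc E ℕ.* suc D)                  ≡⟨ cong (v *_) (ℕtoℚ-* (suc E) (suc D)) ⟩
      v * (ℕtoℚ (suc E) * ℕtoℚ (suc D))           ≡⟨ *-assoc v _ _ ⟨
      v * ℕtoℚ (suc E) * ℕtoℚ (suc D)             ≡⟨ cong (_* ℕtoℚ (suc D)) e ⟩
      ℕtoℚ l * ℕtoℚ (suc D)                       ≡⟨ *-comm (ℕtoℚ l) (ℕtoℚ (suc D)) ⟩
      ℕtoℚ (suc D) * ℕtoℚ l                       ≡⟨ ℕtoℚ-* (suc D) l ⟨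
      ℕtoℚ (suc D ℕ.* l)                          ∎)) eqs)
  where open ≡-Reasoning

common-unit : ∀ xs → All (0ℚ ≤_) xs → ∃ λ U → 0ℚ < U × All (λ x → ∃ λ k → x ≡ ℕtoℚ k * U) xs
common-unit xs 0≤xs with common-denominator xs 0≤xs
... | D , eqs = U , positive⁻¹ U ⦃ 1/pos⇒pos (ℕtoℚ (suc D)) ⦃ posD ⦄ ⦄ , All.map (λ {x} (k , e) → k , (begin
  x                          ≡⟨ *-identityʳ x ⟨
  x * 1ℚ                     ≡⟨ cong (x *_) (*-inverseʳ (ℕtoℚ (suc D))) ⟨
  x * (ℕtoℚ (suc D) * U)     ≡⟨ *-assoc x _ _ ⟨
  x * ℕtoℚ (suc D) * U       ≡⟨ cong (_* U) e ⟩
  ℕtoℚ k * U                 ∎)) eqs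
  where
  open ≡-Reasoning
  posD : Positive (ℕtoℚ (suc D))
  posD = positive (ℕtoℚ-pos D)
  instance
    nz : NonZero (ℕtoℚ (suc D))
    nz = pos⇒nonZero (ℕtoℚ (suc D)) ⦃ posD ⦄
  U = 1/ ℕtoℚ (suc D)

-- Supplies a time origin: relative to it all times are nonnegative and so become natural multiples
-- of a unit.
lower-bound : ∀ xs → ∃ λ c → All (c ≤_) xs
lower-bound [] = 0ℚ , []
lower-bound (x ∷ xs) with lower-bound xs
... | c , c≤xs = x ⊓ c , p⊓q≤p x c ∷ All.map (≤-trans (p⊓q≤q x c)) c≤xs

sumFin-cong : ∀ k {f g : Fin k → ℚ} → (∀ i → f i ≡ g i) → sumFin k f ≡ sumFin k g
sumFin-cong ℕ.zero    eq = refl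
sumFin-cong (ℕ.suc k) eq = cong₂ _+_ (eq zero) (sumFin-cong k (eq ∘ suc))

module Unit (U : ℚ) (0<U : 0ℚ < U) where

  instance
    U-positive : Positive U
    U-positive = positive 0<U

  dur : ℕ → ℚ
  dur k = ℕtoℚ k * U

  dur-+ : ∀ m n → dur (m ℕ.+ n) ≡ dur m + dur n
  dur-+ m n = trans (cong (_* U) (ℕtoℚ-+ m n)) (*-distribʳ-+ U (ℕtoℚ m) (ℕtoℚ n))

  dur-* : ∀ m n → dur (m ℕ.* n) ≡ ℕtoℚ m * dur n
  dur-* m n = trans (cong (_* U) (ℕtoℚ-* m n)) (*-assoc (ℕtoℚ m) (ℕtoℚ n) U)

  dur-mono-≤ : ∀ {m n} → m ℕ.≤ n → dur m ≤ dur n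
  dur-mono-≤ m≤n = *-monoʳ-≤-nonNeg U ⦃ pos⇒nonNeg U ⦄ (ℕtoℚ-mono-≤ m≤n)

  dur-mono-< : ∀ {m n} → m ℕ.< n → dur m < dur n
  dur-mono-< m<n = *-monoˡ-<-pos U (ℕtoℚ-mono-< m<n)

  dur-cancel-≤ : ∀ {m n} → dur m ≤ dur n → m ℕ.≤ n
  dur-cancel-≤ le = ℕ.≮⇒≥ (λ n<m → <-irrefl refl (<-≤-trans (dur-mono-< n<m) le))

  dur-cancel-< : ∀ {m n} → dur m < dur n → m ℕ.< n
  dur-cancel-< lt = ℕ.≰⇒> (λ n≤m → <-irrefl refl (<-≤-trans lt (dur-mono-≤ n≤m)))

  dur-injective : ∀ {m n} → dur m ≡ dur n → m ≡ n
  dur-injective eq = ℕ.≤-antisym (dur-cancel-≤ (≤-reflexive eq)) (dur-cancel-≤ (≤-reflexive (sym eq)))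

  sumFin-dur : ∀ k (f : Fin k → ℕ) → sumFin k (dur ∘ f) ≡ dur (sum f)
  sumFin-dur ℕ.zero    f = sym (*-zeroˡ U)
  sumFin-dur (ℕ.suc k) f = trans (cong (_+_ (dur (f zero))) (sumFin-dur k (f ∘ suc))) (sym (dur-+ (f zero) _))

runs-serves : ∀ {n} (x : Maybe (Fin n)) j → runs x j ≡ ℕtoℚ (𝟙 (serves x j))
runs-serves nothing j = refl
runs-serves (just j′) j with j′ Fin.≟ j
... | yes _ = refl
... | no _  = refl

shift-back : ∀ c x → c + (x - c) ≡ x
shift-back = solve 2 (λ c x → c :+ (x :- c) := x) refl
  where open +-*-Solver

cancel-shift : ∀ c x y → c + (x + y) - (c + x) ≡ y
cancel-shift = solve 3 (λ c x y → c :+ (x :+ y) :- (c :+ x) := y) refl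
  where open +-*-Solver

x+y-x≡y : ∀ x y → x + y - x ≡ y
x+y-x≡y = solve 2 (λ x y → x :+ y :- x := y) refl
  where open +-*-Solver

stretch-length : ∀ e p β → p + (1ℚ - β) * (e - p) ≡ e - β * (e - p)
stretch-length = solve 3 (λ e p β → p :+ (con 1ℚ :- β) :* (e :- p) := e :- β :* (e :- p)) refl
  where open +-*-Solver

p≤q⇒0≤q-p : ∀ {p q} → p ≤ q → 0ℚ ≤ q - p
p≤q⇒0≤q-p {p} {q} p≤q = subst (_≤ q - p) (+-inverseʳ p) (+-monoˡ-≤ (- p) p≤q)

-- Processing times are not listed: as sums of durations between breakpoints of `S` they lie on the
-- grid anyway. The new laxities are listed because `β` may force a finer grid.
record Discretisation {n m} (J : Instance n) (β : ℚ) (S : Schedule n m) : Set where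
  field
    U c : ℚ
    0<U : 0ℚ < U
  open Unit U 0<U public
  grid : ℕ → ℚ
  grid k = c + dur k
  field
    u v h   : Fin n → ℕ
    τ       : Fin (suc (K S)) → ℕ
    release  : ∀ j → r (J j) ≡ grid (u j)
    deadline : ∀ j → d (J j) ≡ grid (v j)
    break    : ∀ k → t S k ≡ grid (τ k)
    laxity   : ∀ j → β * (d (J j) - r (J j) - p (J j)) ≡ dur (h j)

discretise : ∀ {n m} (J : Instance n) β (S : Schedule n m) →
             (∀ j → 0ℚ ≤ β * (d (J j) - r (J j) - p (J j))) → Discretisation J β S
discretise {n} J β S laxity≥0 = record
  { U = proj₁ common ; c = c ; 0<U = proj₁ (proj₂ common)
  ; u = λ j → proj₁ (rs j) ; v = λ j → proj₁ (ds j) ; h = λ j → proj₁ (hs j) ; τ = λ k → proj₁ (ts k)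
  ; release = λ j → on-grid (rs j) ; deadline = λ j → on-grid (ds j) ; break = λ k → on-grid (ts k)
  ; laxity = λ j → proj₂ (hs j) }
  where
  times laxities : List ℚ
  times    = tabulate (λ j → r (J j)) ++ tabulate (λ j → d (J j)) ++ tabulate (t S)
  laxities = tabulate (λ j → β * (d (J j) - r (J j) - p (J j)))
  c = proj₁ (lower-bound times)
  -- Times are taken relative to the origin `c`; laxities are durations and stay as they are.
  common = common-unit (map (_- c) times ++ laxities)
    (All.++⁺ (All.map⁺ (All.map (λ {x} → p≤q⇒0≤q-p {c} {x}) (proj₂ (lower-bound times)))) (All.tabulate⁺ laxity≥0))
  Multiple : ℚ → Set
  Multiple x = ∃ λ k → x ≡ ℕtoℚ k * proj₁ common
  multiples : All Multiple (map (_- c) times ++ laxities)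
  multiples = proj₂ (proj₂ common)
  all-times : All (λ x → Multiple (x - c)) times
  all-times = All.map⁻ (All.++⁻ˡ (map (_- c) times) multiples)
  rs : ∀ j → Multiple (r (J j) - c)
  rs = All.tabulate⁻ (All.++⁻ˡ (tabulate (λ j → r (J j))) all-times)
  ds : ∀ j → Multiple (d (J j) - c)
  ds = All.tabulate⁻ (All.++⁻ˡ (tabulate (λ j → d (J j))) (All.++⁻ʳ (tabulate (λ j → r (J j))) all-times))
  ts : ∀ k → Multiple (t S k - c)
  ts = All.tabulate⁻ {f = t S} (All.++⁻ʳ (tabulate (λ j → d (J j))) (All.++⁻ʳ (tabulate (λ j → r (J j))) all-times))
  hs : ∀ j → Multiple (β * (d (J j) - r (J j) - p (J j)))
  hs = All.tabulate⁻ (All.++⁻ʳ (map (_- c) times) multiples)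
  on-grid : ∀ {x} (e : Multiple (x - c)) → x ≡ c + ℕtoℚ (proj₁ e) * proj₁ common
  on-grid {x} (k , e) = trans (sym (shift-back c x)) (cong (λ y → c + y) e)

-- Transfer between rational schedules and slots

module Stretching {n m} (J : Instance n) (β : ℚ) (wf : WellFormed J) (ht : HalfTight J)
  (a B c : ℕ) (a≢0 : ℕ.NonZero a) (b≡a+c : suc B ≡ a ℕ.+ c) (β-frac : β * ℕtoℚ (suc B) ≡ ℕtoℚ a)
  (S : Schedule n m) (feasible : IsFeasibleSchedule J S) (D : Discretisation J β S)
  (N : ℕ) (N-large : 2 ℕ.* ((a ℕ.+ 2 ℕ.* c) ℕ.* m) ℕ.≤ a ℕ.* N) where

  open Discretisation D renaming (c to offset)

  private
    b = suc B
    S-ordered = proj₁ feasible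
    S-unique  = proj₁ (proj₂ feasible)
    S-window  = proj₁ (proj₂ (proj₂ feasible))
    S-total   = proj₂ (proj₂ (proj₂ feasible))

  grid-mono : ∀ {i k} → i ℕ.≤ k → grid i ≤ grid k
  grid-mono i≤k = +-monoʳ-≤ offset (dur-mono-≤ i≤k)

  grid-cancel : ∀ {i k} → grid i ≤ grid k → i ℕ.≤ k
  grid-cancel {i} {k} le = dur-cancel-≤ (subst₂ _≤_ (x+y-x≡y offset (dur i)) (x+y-x≡y offset (dur k)) (+-monoˡ-≤ (- offset) le))

  grid-diff : ∀ i k → grid (i ℕ.+ k) - grid i ≡ dur k
  grid-diff i k = trans (cong (λ x → offset + x - grid i) (dur-+ i k)) (cancel-shift offset (dur i) (dur k))

  grid-diff-∸ : ∀ {i k} → i ℕ.≤ k → grid k - grid i ≡ dur (k ℕ.∸ i)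
  grid-diff-∸ {i} {k} i≤k = trans (cong (λ x → grid x - grid i) (sym (ℕ.m+[n∸m]≡n i≤k))) (grid-diff i (k ℕ.∸ i))

  -- General in the assignment and the lengths because it is applied both to `S` and to the slotted
  -- schedule `S′`.
  total-time : ∀ {K m} (σ : Fin K → Fin m → Maybe (Fin n)) (δ : Fin K → ℕ) (x : Fin K → ℚ) → (∀ k → x k ≡ dur (δ k)) →
    ∀ j → sumFin K (λ k → sumFin m (λ i → runs (σ k i) j * x k))
        ≡ dur (sum (λ k → count (λ i → serves (σ k i) j) ℕ.* δ k))
  total-time {K} {m} σ δ x x≡ j = trans (sumFin-cong K inner) (sumFin-dur K _)
    where
    open ≡-Reasoning
    inner : ∀ k → sumFin m (λ i → runs (σ k i) j * x k) ≡ dur (count (λ i → serves (σ k i) j) ℕ.* δ k)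
    inner k = begin
      sumFin m (λ i → runs (σ k i) j * x k)                     ≡⟨ sumFin-cong m (λ i → trans (cong₂ _*_ (runs-serves (σ k i) j) (x≡ k)) (sym (dur-* (𝟙 (serves (σ k i) j)) (δ k)))) ⟩
      sumFin m (λ i → dur (𝟙 (serves (σ k i) j) ℕ.* δ k))       ≡⟨ sumFin-dur m _ ⟩
      dur (sum (λ i → 𝟙 (serves (σ k i) j) ℕ.* δ k))            ≡⟨ cong dur (*-distribʳ-sum (δ k) (λ i → 𝟙 (serves (σ k i) j))) ⟨
      dur (count (λ i → serves (σ k i) j) ℕ.* δ k)              ∎

  τ-mono : ∀ k → τ (inject₁ k) ℕ.≤ τ (suc k)
  τ-mono k = grid-cancel (subst₂ _≤_ (break (inject₁ k)) (break (suc k)) (S-ordered k))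

  module Original = Slotted τ τ-mono (σ S) S-unique

  -- A sum of naturals is a convenient common upper bound for all deadlines and breakpoints.
  T : ℕ
  T = sum v ℕ.+ sum τ

  P : Fin n → ℕ
  P j = sum {T} (Original.y j ∘ toℕ)

  p≡dur : ∀ j → p (J j) ≡ dur (P j)
  p≡dur j = begin
    p (J j)            ≡⟨ S-total j ⟨
    _                  ≡⟨ total-time (σ S) (λ k → τ (suc k) ℕ.∸ τ (inject₁ k)) (λ k → end S k - start S k)
                            (λ k → trans (cong₂ _-_ (break (suc k)) (break (inject₁ k))) (grid-diff-∸ (τ-mono k))) j ⟩
    _                  ≡⟨ cong dur (Original.y-total T (λ k → ℕ.≤-trans (term≤sum τ k) (ℕ.m≤n+m (sum τ) (sum v))) j) ⟨
    dur (P j)          ∎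
    where open ≡-Reasoning

  module _ (j : Fin n) where

    private
      e = d (J j) - r (J j)

    ½+½ : ∀ e → ½ * e + ½ * e ≡ e
    ½+½ e = trans (sym (*-distribʳ-+ e ½ ½)) (*-identityˡ e)

    e<p+p : e < p (J j) + p (J j)
    e<p+p = subst (_< p (J j) + p (J j)) (½+½ e) (+-mono-< (ht j) (ht j))

    -- Being realised by `S`, `p` is a number of slots times `U`. With `p ≤ d - r` this puts the
    -- ends of the window in order.
    0≤p : 0ℚ ≤ p (J j)
    0≤p = subst (0ℚ ≤_) (sym (p≡dur j)) (subst (_≤ dur (P j)) (*-zeroˡ U) (dur-mono-≤ {0} {P j} z≤n))

    u≤v : u j ℕ.≤ v j
    u≤v = grid-cancel (subst₂ _≤_ (release j) (deadline j)
      (subst₂ _≤_ (+-identityʳ (r (J j))) (shift-back (r (J j)) (d (J j))) (+-monoʳ-≤ (r (J j)) (≤-trans 0≤p (wf j)))))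

    k : ℕ
    k = v j ℕ.∸ u j

    u+k≡v : u j ℕ.+ k ≡ v j
    u+k≡v = ℕ.m+[n∸m]≡n u≤v

    e≡dur : e ≡ dur k
    e≡dur = trans (cong₂ _-_ (deadline j) (release j)) (grid-diff-∸ u≤v)

    P≤k : P j ℕ.≤ k
    P≤k = dur-cancel-≤ (subst₂ _≤_ (p≡dur j) e≡dur (wf j))

    l : ℕ
    l = k ℕ.∸ P j

    k≡P+l : k ≡ P j ℕ.+ l
    k≡P+l = sym (ℕ.m+[n∸m]≡n P≤k)

    tight : l ℕ.≤ P j
    tight = ℕ.m≤n+o⇒m∸n≤o k (P j) (ℕ.<⇒≤ (dur-cancel-< (subst₂ _<_ e≡dur
      (trans (cong₂ _+_ (p≡dur j) (p≡dur j)) (sym (dur-+ (P j) (P j)))) e<p+p)))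

    e-p≡dur : e - p (J j) ≡ dur l
    e-p≡dur = begin
      e - p (J j)                       ≡⟨ cong₂ _-_ (trans e≡dur (trans (cong dur k≡P+l) (dur-+ (P j) l))) (p≡dur j) ⟩
      dur (P j) + dur l - dur (P j)     ≡⟨ x+y-x≡y (dur (P j)) (dur l) ⟩
      dur l                             ∎
      where open ≡-Reasoning

    -- This is h = βl cleared of the denominator of β = a / b; positivity of `U` lets the equation
    -- descend from durations to naturals.
    scaled : (a ℕ.+ c) ℕ.* h j ≡ a ℕ.* l
    scaled = dur-injective (begin
      dur ((a ℕ.+ c) ℕ.* h j)           ≡⟨ cong (λ x → dur (x ℕ.* h j)) b≡a+c ⟨
      dur (b ℕ.* h j)                   ≡⟨ dur-* b (h j) ⟩
      ℕtoℚ b * dur (h j)                ≡⟨ cong (ℕtoℚ b *_) (laxity j) ⟨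
      ℕtoℚ b * (β * (e - p (J j)))      ≡⟨ *-assoc (ℕtoℚ b) β _ ⟨
      ℕtoℚ b * β * (e - p (J j))        ≡⟨ cong₂ _*_ (trans (*-comm (ℕtoℚ b) β) β-frac) e-p≡dur ⟩
      ℕtoℚ a * dur l                    ≡⟨ dur-* a l ⟨
      dur (a ℕ.* l)                     ∎)
      where open ≡-Reasoning

    h≤k : h j ℕ.≤ k
    h≤k = ℕ.*-cancelˡ-≤ b (begin
      b ℕ.* h j             ≡⟨ cong (ℕ._* h j) b≡a+c ⟩
      (a ℕ.+ c) ℕ.* h j     ≡⟨ scaled ⟩
      a ℕ.* l               ≤⟨ ℕ.*-mono-≤ (ℕ.m≤m+n a c) (ℕ.m∸n≤m k (P j)) ⟩
      (a ℕ.+ c) ℕ.* k       ≡⟨ cong (ℕ._* k) b≡a+c ⟨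
      b ℕ.* k               ∎)
      where open ℕ.≤-Reasoning

    q : ℕ
    q = k ℕ.∸ h j

    k≡q+h : k ≡ q ℕ.+ h j
    k≡q+h = sym (ℕ.m∸n+n≡m h≤k)

    stretched : p (stretch β J j) ≡ dur q
    stretched = begin
      p (J j) + (1ℚ - β) * (e - p (J j))    ≡⟨ stretch-length e (p (J j)) β ⟩
      e - β * (e - p (J j))                 ≡⟨ cong₂ _-_ (trans e≡dur (trans (cong dur (trans k≡q+h (ℕ.+-comm q (h j)))) (dur-+ (h j) q))) (laxity j) ⟩
      dur (h j) + dur q - dur (h j)         ≡⟨ x+y-x≡y (dur (h j)) (dur q) ⟩
      dur q                                 ∎
      where open ≡-Reasoning

    u+k≤T : u j ℕ.+ k ℕ.≤ T
    u+k≤T = ℕ.≤-trans (ℕ.≤-reflexive u+k≡v) (ℕ.≤-trans (term≤sum v j) (ℕ.m≤m+n _ _))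

    y≤win : ∀ (s : Fin T) → Original.y j (toℕ s) ℕ.≤ 𝟙 (between (u j) (u j ℕ.+ k) (toℕ s))
    y≤win s = Original.y-window j (λ k′ i e → let ≤start , end≤ = S-window k′ i j e in
      grid-cancel (subst₂ _≤_ (release j) (break (inject₁ k′)) ≤start) ,
      subst (τ (suc k′) ℕ.≤_) (sym u+k≡v) (grid-cancel (subst₂ _≤_ (break (suc k′)) (deadline j) end≤))) (toℕ s)

  abstract
    slots : ∃ λ (z : Fin n → Fin T → Bool) → (∀ j s → z j s ≡ true → between (u j) (u j ℕ.+ k j) (toℕ s) ≡ true)
              × (∀ j → count (z j) ≡ q j) × (∀ s → count (λ j → z j s) ℕ.≤ N)
    slots = Discrete.discrete a c m N ⦃ a≢0 ⦄ N-large u k P l q h u+k≤T k≡P+l k≡q+h scaled tight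
              (λ j s → Original.y j (toℕ s)) y≤win (λ j → refl) (λ s → Original.y-load (toℕ s))

  z : Fin n → Fin T → Bool
  z = proj₁ slots

  machine : Fin T → Fin N → Maybe (Fin n)
  machine s = proj₁ (distribute N (λ j → z j s) (proj₂ (proj₂ (proj₂ slots)) s))

  machine-count : ∀ s j → count (λ i → serves (machine s i) j) ≡ 𝟙 (z j s)
  machine-count s = proj₂ (distribute N (λ j → z j s) (proj₂ (proj₂ (proj₂ slots)) s))

  S′ : Schedule n N
  S′ = record { K = T ; t = λ s → grid (toℕ s) ; σ = machine }

  slot-length : ∀ s → end S′ s - start S′ s ≡ dur 1
  slot-length s = begin
    grid (suc (toℕ s)) - grid (toℕ (inject₁ s))     ≡⟨ cong₂ (λ x y → grid x - grid y) (ℕ.+-comm 1 (toℕ s)) (Fin.toℕ-inject₁ s) ⟩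
    grid (toℕ s ℕ.+ 1) - grid (toℕ s)               ≡⟨ grid-diff (toℕ s) 1 ⟩
    dur 1                                           ∎
    where open ≡-Reasoning

  S′-feasible : IsFeasibleSchedule (stretch β J) S′
  S′-feasible = ordered , unique , window , total
    where
    ordered : ∀ s → start S′ s ≤ end S′ s
    ordered s = grid-mono (ℕ.≤-trans (ℕ.≤-reflexive (Fin.toℕ-inject₁ s)) (ℕ.n≤1+n _))
    unique : ∀ s i i′ j → machine s i ≡ just j → machine s i′ ≡ just j → i ≡ i′
    unique s = Distributed.σ-unique (machine s) (λ j → z j s) (machine-count s)
    window : ∀ s i j → machine s i ≡ just j → r (J j) ≤ start S′ s × end S′ s ≤ d (J j)
    window s i j e with between-sound {u j} (proj₁ (proj₂ slots) j s (Distributed.σ-sound (machine s) (λ j → z j s) (machine-count s) i j e))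
    ... | u≤s , s<u+k =
      ≤-trans (≤-reflexive (release j)) (grid-mono (ℕ.≤-trans u≤s (ℕ.≤-reflexive (sym (Fin.toℕ-inject₁ s))))) ,
      ≤-trans (grid-mono (ℕ.≤-trans s<u+k (ℕ.≤-reflexive (u+k≡v j)))) (≤-reflexive (sym (deadline j)))
    total : ∀ j → sumFin T (λ s → sumFin N (λ i → runs (machine s i) j * (end S′ s - start S′ s))) ≡ p (stretch β J j)
    total j = begin
      _                                                                ≡⟨ total-time machine (λ _ → 1) _ slot-length j ⟩
      dur (sum {T} (λ s → count (λ i → serves (machine s i) j) ℕ.* 1)) ≡⟨ cong dur (sum-cong-≗ {T} (λ s → trans (ℕ.*-identityʳ _) (machine-count s j))) ⟩
      dur (count (z j))                                                ≡⟨ cong dur (proj₁ (proj₂ (proj₂ slots)) j) ⟩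
      dur (q j)                                                        ≡⟨ stretched j ⟨
      p (stretch β J j)                                                ∎
      where open ≡-Reasoning

  abstract
    stretched-feasible : Feasible (stretch β J) N
    stretched-feasible = S′ , S′-feasible

-- The bound for minimum machine numbers

theorem19 : ∀ (n : ℕ) (J : Instance n) (β : ℚ)
    → WellFormed J → HalfTight J
    → 0ℚ < β → β < 1ℚ
    → ∀ (mJ mJβ : ℕ) → IsMinMachines J mJ → IsMinMachines (stretch β J) mJβ
    → β * ℕtoℚ mJβ ≤ ℕtoℚ 4 * ℕtoℚ mJ
theorem19 n J β wf ht 0<β β<1 m mβ ((S , feasible) , _) (_ , minimal) with natural-multiple β (<⇒≤ 0<β)
-- Multiplied by the denominator `b` of `β`, the bound reads `a * mβ ≤ 4 * (b * m)` in ℕ. It follows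
-- from `mβ ≤ N`, by minimality, and the choice of `N`.
... | B , a , frac = *-cancelˡ-≤-pos (ℕtoℚ b) (begin
  ℕtoℚ b * (β * ℕtoℚ mβ)          ≡⟨ *-assoc (ℕtoℚ b) β _ ⟨
  ℕtoℚ b * β * ℕtoℚ mβ            ≡⟨ cong (_* ℕtoℚ mβ) (trans (*-comm (ℕtoℚ b) β) frac) ⟩
  ℕtoℚ a * ℕtoℚ mβ                ≡⟨ ℕtoℚ-* a mβ ⟨
  ℕtoℚ (a ℕ.* mβ)                 ≤⟨ ℕtoℚ-mono-≤ (ℕ.≤-trans (ℕ.*-monoʳ-≤ a (minimal N stretched-feasible)) N-small) ⟩
  ℕtoℚ (4 ℕ.* ((a ℕ.+ c) ℕ.* m))  ≡⟨ cong (λ x → ℕtoℚ (4 ℕ.* (x ℕ.* m))) (sym b≡a+c) ⟩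
  ℕtoℚ (4 ℕ.* (b ℕ.* m))          ≡⟨ trans (ℕtoℚ-* 4 (b ℕ.* m)) (cong (ℕtoℚ 4 *_) (ℕtoℚ-* b m)) ⟩
  ℕtoℚ 4 * (ℕtoℚ b * ℕtoℚ m)      ≡⟨ swap (ℕtoℚ 4) (ℕtoℚ b) (ℕtoℚ m) ⟩
  ℕtoℚ b * (ℕtoℚ 4 * ℕtoℚ m)      ∎)
  where
  open ≤-Reasoning
  b = suc B
  swap : ∀ x y z → x * (y * z) ≡ y * (x * z)
  swap = solve 3 (λ x y z → x :* (y :* z) := y :* (x :* z)) refl
    where open +-*-Solver
  instance
    b-positive : Positive (ℕtoℚ b)
    b-positive = positive (ℕtoℚ-pos B)
    β-nonNeg : NonNegative β
    β-nonNeg = nonNegative (<⇒≤ 0<β)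
  a≤b : a ℕ.≤ b
  a≤b = ℕ.≮⇒≥ λ b<a → <-irrefl refl (begin-strict
    ℕtoℚ b         <⟨ ℕtoℚ-mono-< b<a ⟩
    ℕtoℚ a         ≡⟨ frac ⟨
    β * ℕtoℚ b     <⟨ *-monoˡ-<-pos (ℕtoℚ b) β<1 ⟩
    1ℚ * ℕtoℚ b    ≡⟨ *-identityˡ (ℕtoℚ b) ⟩
    ℕtoℚ b         ∎)
  a≢0 : ℕ.NonZero a
  a≢0 = ℕ.≢-nonZero λ { refl → <-irrefl refl (begin-strict
    0ℚ             ≡⟨ *-zeroˡ (ℕtoℚ b) ⟨
    0ℚ * ℕtoℚ b    <⟨ *-monoˡ-<-pos (ℕtoℚ b) 0<β ⟩
    β * ℕtoℚ b     ≡⟨ frac ⟩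
    0ℚ             ∎) }
  -- Thus c / b = 1 - β; by `a≤b` the subtraction does not truncate.
  c = b ℕ.∸ a
  b≡a+c : b ≡ a ℕ.+ c
  b≡a+c = sym (ℕ.m+[n∸m]≡n a≤b)
  bound : ∃ λ N → a ℕ.* N ℕ.≤ 4 ℕ.* ((a ℕ.+ c) ℕ.* m) × 2 ℕ.* ((a ℕ.+ 2 ℕ.* c) ℕ.* m) ℕ.≤ a ℕ.* N
  bound = machines a c m ⦃ a≢0 ⦄
  N = proj₁ bound
  N-small = proj₁ (proj₂ bound)
  D : Discretisation J β S
  D = discretise J β S λ j → subst (_≤ β * (d (J j) - r (J j) - p (J j))) (*-zeroʳ β) (*-monoˡ-≤-nonNeg β (p≤q⇒0≤q-p (wf j)))
  open Stretching J β wf ht a B c a≢0 b≡a+c frac S feasible D N (proj₂ (proj₂ bound)) using (stretched-feasible)
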